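{- Let $t=2m+2\ge4$ be even, $r\ge1$, $R=r+m$, $N=t+2r$, and let $\lambda$ be a partition with fewer than $N$ parts. Then for every partition $\mu$ with at most $r$ parts, $$\sum_\nu\varepsilon^{(t)}_{\lambda,\nu}\,b_{\nu\mu}=\sum_\eta B_{\eta,\mu}\,\tau^C_t(\eta),$$ where $\nu$ runs over partitions with at most $2r$ parts and $\eta$ over partitions with at most $m$ parts, and $\varepsilon^{(t)}_{\lambda,\nu}$, $b_{\nu\mu}$, $B_{\eta,\mu}$, $\tau^C_t(\eta)$ are as in the context.
   Context: Let $\zeta=\xi=e^{2\pi i/t}$ and $\mu_t=\{1,\zeta,\dots,\zeta^{t-1}\}$. $\mathrm{sp}_\eta$ denotes an irreducible symplectic character, written in torus variables. - $\varepsilon^{(t)}_{\lambda,\nu}=s_{\lambda/\nu}(\mu_t)$, the skew Schur polynomial evaluated at all $t$-th roots of unity. - $b_{\nu\mu}$ is the multiplicity of the irreducible $\mathrm{Sp}_{2r}$-module of highest weight $\mu$ in the restriction to $\mathrm{Sp}_{2r}$ of the irreducible polynomial $GL_{2r}$-module of highest weight $\nu$. - $B_{\eta,\mu}\in\mathbb Z$ are the coefficients (depending on $\lambda$) in $s_\lambda(1,-1,y_1^{\pm1},\dots,y_m^{\pm1},z_1^{\pm1},\dots,z_r^{\pm1})=\sum_{\eta,\mu}B_{\eta,\mu}\,\mathrm{sp}_\eta(y)\,\mathrm{sp}_\mu(z)$, with $\mathrm{sp}_\eta$ a character of $\mathrm{Sp}_{2m}$ and $\mathrm{sp}_\mu$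 of $\mathrm{Sp}_{2r}$. - $\tau^C_t(\eta)=\mathrm{sp}_\eta(\xi,\xi^2,\dots,\xi^m)$. -}

module Defs where

open import Algebra.Apartness.Bundles using (HeytingField; HeytingCommutativeRing)
open import Algebra.Bundles using (CommutativeRing)
import Algebra.Properties.CommutativeSemiring.Exp as Exp
import Algebra.Properties.Monoid.Mult as Mult
import Algebra.Properties.Monoid.Sum as Sum
open import Data.Fin as Fin using (Fin; splitAt; toℕ)
import Data.Fin.Properties as Fin
open import Data.Integer as ℤ using (ℤ; +_; -[1+_])
open import Data.List as List using (List; []; _∷_; applyUpTo; cartesianProductWith; foldr; length; tabulate)
import Data.List.Properties as List
open import Data.List.Membership.Propositional using (_∉_)
open import Data.List.Relation.Unary.All using (All)
open import Data.List.Relation.Unary.Linked using (Linked)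
open import Data.List.Relation.Unary.Unique.Propositional using (Unique)
open import Data.Nat as ℕ using (ℕ; zero; suc; _∸_)
import Data.Nat.ListAction as ℕ using (sum)
open import Data.Product using (∃-syntax; _×_; _,_; proj₁)
open import Data.Sum using (inj₁; inj₂; [_,_])
open import Data.Vec as Vec using (Vec; _[_]≔_; zipWith)
open import Data.Vec.Functional using (Vector)
open import Function using (_∘_)
open import Level using (_⊔_) renaming (suc to lsuc)
open import Relation.Binary.Construct.Closure.ReflexiveTransitive using (Star)
open import Relation.Binary.Definitions using (DecidableEquality)
open import Relation.Binary.PropositionalEquality as ≡ using (_≡_)
open import Relation.Nullary using (does; ¬_)
open import Relation.Nullary.Decidable using (map′)
open import Relation.Unary using (Pred)
open import Data.Bool using (if_then_else_)

-- The proofs are irrelevant fields, so equality of partitions is equality of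
-- their lists of parts.

record Partition : Set where
  constructor mkPartition
  field
    parts       : List ℕ
    .decreasing : Linked ℕ._≥_ parts
    .positive   : All (0 ℕ.<_) parts

open Partition public

record PartitionAtMost (n : ℕ) : Set where
  constructor mkPartitionAtMost
  field
    partition : Partition
    .bound    : length (parts partition) ℕ.≤ n

open PartitionAtMost public

partsOf : ∀ {n} → PartitionAtMost n → List ℕ
partsOf = parts ∘ partition

infix 4 _≟ᴾ_

_≟ᴾ_ : ∀ {n} → DecidableEquality (PartitionAtMost n)
mkPartitionAtMost (mkPartition p _ _) _ ≟ᴾ mkPartitionAtMost (mkPartition q _ _) _ =
  map′ (λ { ≡.refl → ≡.refl }) (λ { ≡.refl → ≡.refl }) (List.≡-dec ℕ._≟_ p q)

-- All partitions κ for which λ/κ is a horizontal strip, i.e.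
-- λ₁ ≥ κ₁ ≥ λ₂ ≥ κ₂ ≥ …, without repetition.
removeStrip : List ℕ → List (List ℕ)
removeStrip []          = [] ∷ []
removeStrip (a ∷ [])    = [] ∷ applyUpTo (λ k → suc k ∷ []) a
removeStrip (a ∷ b ∷ p) =
  cartesianProductWith _∷_ (applyUpTo (b ℕ.+_) (suc (a ∸ b))) (removeStrip (b ∷ p))

Weight : ℕ → Set
Weight n = Vec ℤ n

infixl 6 _⊕_ _⊖_

_⊕_ _⊖_ : ∀ {n} → Weight n → Weight n → Weight n
_⊕_ = zipWith ℤ._+_
_⊖_ = zipWith ℤ._-_

e : ∀ {n} → Fin n → Weight n
e i = Vec.replicate _ (+ 0) [ i ]≔ + 1

part : List ℕ → ℕ → ℕ
part []      _       = 0
part (a ∷ _) zero    = a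
part (_ ∷ p) (suc i) = part p i

partitionWeight : ∀ {n} → PartitionAtMost n → Weight n
partitionWeight p = Vec.tabulate (λ i → + part (partsOf p) (toℕ i))

data PositiveRootA {n} : Weight n → Set where
  e-e : ∀ {i j} → i Fin.< j → PositiveRootA (e i ⊖ e j)

data PositiveRootC {n} : Weight n → Set where
  e-e : ∀ {i j} → i Fin.< j → PositiveRootC (e i ⊖ e j)
  e+e : ∀ {i j} → i Fin.≤ j → PositiveRootC (e i ⊕ e j)

module Characters {c ℓ₁ ℓ₂} (F : HeytingField c ℓ₁ ℓ₂) where

  open HeytingField F hiding (_-_)

  commutativeRing : CommutativeRing c ℓ₁
  commutativeRing = HeytingCommutativeRing.commutativeRing heytingCommutativeRing

  open CommutativeRing commutativeRing public
    using (+-monoid; *-monoid; commutativeSemiring)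
  open Exp commutativeSemiring public using (_^_)
  open Mult +-monoid public renaming (_×_ to _·ℕ_) using ()
  open Sum +-monoid public using (sum)
  open Sum *-monoid public renaming (sum to product) using ()

  infixr 8 _·ℤ_

  _·ℤ_ : ℤ → Carrier → Carrier
  (+ n)    ·ℤ x = n ·ℕ x
  -[1+ n ] ·ℤ x = - (suc n ·ℕ x)

  CharacteristicZero : Set ℓ₂
  CharacteristicZero = ∀ n → suc n ·ℕ 1# # 0#

  sumList : ∀ {a} {I : Set a} → (I → Carrier) → List I → Carrier
  sumList f = foldr (λ i s → f i + s) 0#

  -- s is the sum of the finitely supported family f.
  record HasSum {I : Set} (f : I → Carrier) (s : Carrier) : Set (c ⊔ ℓ₁) where
    field
      support  : List I
      distinct : Unique support
      vanish   : ∀ i → i ∉ support → f i ≈ 0#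
      total    : s ≈ sumList f support

  record Unit : Set (c ⊔ ℓ₁) where
    constructor mkUnit
    field
      val     : Carrier
      inv     : Carrier
      val*inv : val * inv ≈ 1#

  open Unit public

  infix 9 _⁻¹
  infixr 8 _^ᵘ_ _^ᶻ_

  _⁻¹ : Unit → Unit
  u ⁻¹ = mkUnit (inv u) (val u) (trans (*-comm _ _) (val*inv u))

  1ᵘ : Unit
  1ᵘ = mkUnit 1# 1# (*-identityˡ 1#)

  _*ᵘ_ : Unit → Unit → Unit
  u *ᵘ v = mkUnit (val u * val v) (inv v * inv u)
    (trans (*-assoc _ _ _)
      (trans (*-congˡ (trans (sym (*-assoc _ _ _))
        (trans (*-congʳ (val*inv v)) (*-identityˡ _))))
        (val*inv u)))

  _^ᵘ_ : Unit → ℕ → Unit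
  u ^ᵘ zero  = 1ᵘ
  u ^ᵘ suc n = u *ᵘ (u ^ᵘ n)

  _^ᶻ_ : Unit → ℤ → Carrier
  u ^ᶻ (+ n)    = val u ^ n
  u ^ᶻ -[1+ n ] = inv u ^ suc n

  monomial : ∀ {n} → (Fin n → Unit) → Weight n → Carrier
  monomial z w = product (λ i → z i ^ᶻ Vec.lookup w i)

  record PrimitiveRoot (t : ℕ) : Set (c ⊔ ℓ₁ ⊔ ℓ₂) where
    field
      ξ         : Unit
      root      : val ξ ^ t ≈ 1#
      order     : ∀ k → 0 ℕ.< k → k ℕ.< t → val ξ ^ k # 1#

  open PrimitiveRoot public

  rootsOfUnity : ∀ {t} → PrimitiveRoot t → List Carrier
  rootsOfUnity {t} ζ = applyUpTo (val (ξ ζ) ^_) t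

  -- s_{λ/ν}(x₁,…,xₙ) as the generating function of semistandard tableaux of
  -- shape λ/ν.  Such a tableau is a chain of partitions from λ down to ν whose
  -- successive differences are horizontal strips, one for each variable; a
  -- strip of size k filled with the letter of x contributes x^k.
  skewSchur : List ℕ → List ℕ → List Carrier → Carrier
  skewSchur p q []       = if does (List.≡-dec ℕ._≟_ p q) then 1# else 0#
  skewSchur p q (x ∷ xs) =
    sumList (λ k → x ^ (ℕ.sum p ∸ ℕ.sum k) * skewSchur k q xs) (removeStrip p)

  schur : List ℕ → List Carrier → Carrier
  schur p = skewSchur p []

  Matrix : ℕ → ℕ → Set c
  Matrix m n = Vector (Vector Carrier n) m

  infix  4 _≈ᴹ_
  infixl 7 _·_

  _≈ᴹ_ : ∀ {m n} → Matrix m n → Matrix m n → Set ℓ₁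
  A ≈ᴹ B = ∀ i j → A i j ≈ B i j

  _·_ : ∀ {l m n} → Matrix l m → Matrix m n → Matrix l n
  (A · B) i j = sum (λ k → A i k * B k j)

  _ᵀ : ∀ {m n} → Matrix m n → Matrix n m
  (A ᵀ) i j = A j i

  diagonal : ∀ {n} → (Fin n → Carrier) → Matrix n n
  diagonal d i j = if does (i Fin.≟ j) then d i else 0#

  𝟙 : ∀ {n} → Matrix n n
  𝟙 = diagonal (λ _ → 1#)

  𝟘 : ∀ {m n} → Matrix m n
  𝟘 _ _ = 0#

  trace : ∀ {n} → Matrix n n → Carrier
  trace A = sum (λ i → A i i)

  _*ᵥ_ : ∀ {m n} → Matrix m n → Vector Carrier n → Vector Carrier m
  (A *ᵥ v) i = sum (λ j → A i j * v j)

  Invertible : ∀ {n} → Matrix n n → Set (c ⊔ ℓ₁)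
  Invertible {n} A = ∃[ B ] (A · B ≈ᴹ 𝟙 {n}) × (B · A ≈ᴹ 𝟙 {n})

  -- The standard symplectic form, with block matrix (0 I; -I 0).
  J : ∀ r → Matrix (r ℕ.+ r) (r ℕ.+ r)
  J r i j with splitAt r i | splitAt r j
  ... | inj₁ k | inj₂ l = 𝟙 k l
  ... | inj₂ k | inj₁ l = - 𝟙 k l
  ... | inj₁ _ | inj₁ _ = 0#
  ... | inj₂ _ | inj₂ _ = 0#

  record LinearGroup : Set (lsuc (c ⊔ ℓ₁)) where
    field
      size         : ℕ
      Member       : Matrix size size → Set (c ⊔ ℓ₁)
      rank         : ℕ
      torus        : (Fin rank → Unit) → Matrix size size
      PositiveRoot : Weight rank → Set

  open LinearGroup public

  GL : ℕ → LinearGroup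
  GL n = record
    { size         = n
    ; Member       = Invertible
    ; rank         = n
    ; torus        = λ x → diagonal (val ∘ x)
    ; PositiveRoot = PositiveRootA
    }

  z,z⁻¹ : ∀ {r} → (Fin r → Unit) → Fin (r ℕ.+ r) → Unit
  z,z⁻¹ {r} z i = [ z , (λ k → z k ⁻¹) ] (splitAt r i)

  Sp : ℕ → LinearGroup
  Sp r = record
    { size         = r ℕ.+ r
    ; Member       = λ g → Invertible g × (g ᵀ · J r · g ≈ᴹ J r)
    ; rank         = r
    ; torus        = λ z → diagonal (val ∘ z,z⁻¹ z)
    ; PositiveRoot = PositiveRootC
    }

  data Polynomial (n : ℕ) : Set c where
    con       : Carrier → Polynomial n
    entry     : Fin n → Fin n → Polynomial n
    _:+_ _:*_ : Polynomial n → Polynomial n → Polynomial n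

  eval : ∀ {n} → Polynomial n → Matrix n n → Carrier
  eval (con a)     g = a
  eval (entry i j) g = g i j
  eval (p :+ q)    g = eval p g + eval q g
  eval (p :* q)    g = eval p g * eval q g

  -- A finite-dimensional representation whose matrix coefficients are
  -- polynomials in the entries of the group element.  For GL n these are the
  -- polynomial representations; for Sp r they are all rational representations,
  -- since det = 1 on the symplectic group.
  record Module (G : LinearGroup) : Set (c ⊔ ℓ₁) where
    field
      dim         : ℕ
      coefficient : Fin dim → Fin dim → Polynomial (size G)

    ρ : Matrix (size G) (size G) → Matrix dim dim
    ρ g i j = eval (coefficient i j) g

    field
      ρ-identity : ρ 𝟙 ≈ᴹ 𝟙
      ρ-multiply : ∀ g h → Member G g → Member G h → ρ (g · h) ≈ᴹ ρ g · ρ h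

  open Module public

  character : ∀ {G} → Module G → (Fin (rank G) → Unit) → Carrier
  character {G} V z = trace (ρ V (torus G z))

  record IsSubmodule {G} (V : Module G) {p} (W : Pred (Vector Carrier (dim V)) p) :
                     Set (c ⊔ ℓ₁ ⊔ p) where
    field
      resp   : ∀ {v w} → (∀ i → v i ≈ w i) → W v → W w
      zeroᵥ  : W (λ _ → 0#)
      add    : ∀ {v w} → W v → W w → W (λ i → v i + w i)
      scale  : ∀ a {v} → W v → W (λ i → a * v i)
      stable : ∀ g → Member G g → ∀ {v} → W v → W (ρ V g *ᵥ v)

  -- The module is nonzero, and every submodule containing a nonzero vector is
  -- the whole module.
  Irreducible : ∀ {G} → Module G → Set (lsuc (c ⊔ ℓ₁ ⊔ ℓ₂))
  Irreducible V = (0 ℕ.< dim V) ×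
    ((W : Pred (Vector Carrier (dim V)) (c ⊔ ℓ₁ ⊔ ℓ₂)) → IsSubmodule V W →
     ∀ v → W v → (∃[ i ] v i # 0#) → ∀ w → W w)

  -- The columns of `basis` are a basis of weight vectors; μ is a weight, and
  -- every weight is μ minus a sum of positive roots.
  record HasHighestWeight {G} (V : Module G) (μ : Weight (rank G)) :
                          Set (c ⊔ ℓ₁) where
    field
      basis       : Matrix (dim V) (dim V)
      invertible  : Invertible basis
      weights     : Fin (dim V) → Weight (rank G)
      diagonalise : ∀ z → ρ V (torus G z) · basis
                            ≈ᴹ basis · diagonal (λ k → monomial z (weights k))
      attained    : ∃[ k ] weights k ≡ μ
      highest     : ∀ k → Star (λ v w → ∃[ α ] PositiveRoot G α × v ≡ w ⊕ α)
                               μ (weights k)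

  -- The irreducible polynomial GL n-module of highest weight ν.  By Schur's
  -- classification its character is the Schur polynomial s_ν; this classical
  -- fact is recorded as a field, although in characteristic 0 it follows from
  -- the others.
  record IrreducibleGL (n : ℕ) (ν : PartitionAtMost n) : Set (lsuc (c ⊔ ℓ₁ ⊔ ℓ₂)) where
    field
      polynomialModule : Module (GL n)
      irreducible      : Irreducible polynomialModule
      highestWeight    : HasHighestWeight polynomialModule (partitionWeight ν)
      schurCharacter   : ∀ x → character polynomialModule x
                                 ≈ schur (partsOf ν) (tabulate (val ∘ x))

  record IrreducibleSp (r : ℕ) (μ : PartitionAtMost r) : Set (lsuc (c ⊔ ℓ₁ ⊔ ℓ₂)) where
    field
      rationalModule : Module (Sp r)
      irreducible    : Irreducible rationalModule
      highestWeight  : HasHighestWeight rationalModule (partitionWeight μ)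

  open IrreducibleGL public using (polynomialModule)
  open IrreducibleSp public using (rationalModule)

  sp : ∀ {r} → (∀ μ → IrreducibleSp r μ) → PartitionAtMost r → (Fin r → Unit) → Carrier
  sp L μ = character (rationalModule (L μ))

  restrict : ∀ {r} → Module (GL (r ℕ.+ r)) → Module (Sp r)
  restrict V = record
    { dim         = dim V
    ; coefficient = coefficient V
    ; ρ-identity  = ρ-identity V
    ; ρ-multiply  = λ g h g∈ h∈ → ρ-multiply V g h (proj₁ g∈) (proj₁ h∈)
    }

  -- V is the direct sum of the modules L (constituents k), exhibited by
  -- equivariant inclusions and the complementary projections.
  record Decomposition {r} (L : ∀ μ → IrreducibleSp r μ) (V : Module (Sp r)) :
                       Set (c ⊔ ℓ₁) where
    field
      count        : ℕ
      constituents : Vec (PartitionAtMost r) count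

    summand : Fin count → Module (Sp r)
    summand k = rationalModule (L (Vec.lookup constituents k))

    field
      inclusion   : ∀ k → Matrix (dim V) (dim (summand k))
      projection  : ∀ k → Matrix (dim (summand k)) (dim V)
      equivariant : ∀ k g → Member (Sp r) g →
                    ρ V g · inclusion k ≈ᴹ inclusion k · ρ (summand k) g
      retract     : ∀ k → projection k · inclusion k ≈ᴹ 𝟙
      orthogonal  : ∀ k l → ¬ k ≡ l → projection k · inclusion l ≈ᴹ 𝟘
      exhaustive  : ∀ i j → sum (λ k → (inclusion k · projection k) i j) ≈ 𝟙 i j

  multiplicity : ∀ {r} {L : ∀ μ → IrreducibleSp r μ} {V} →
                 Decomposition L V → PartitionAtMost r → ℕ
  multiplicity D μ = Vec.count (_≟ᴾ μ) (Decomposition.constituents D)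

  -- An identity of Laurent polynomials f(y,z) = ∑ B_{η,μ} sp_η(y) sp_μ(z) with
  -- finitely many nonzero B_{η,μ}, stated on all points with invertible
  -- coordinates.
  record SymplecticExpansion {m r} (M : ∀ η → IrreducibleSp m η) (L : ∀ μ → IrreducibleSp r μ)
         (f : (Fin m → Unit) → (Fin r → Unit) → Carrier) : Set (c ⊔ ℓ₁) where
    field
      B         : PartitionAtMost m → PartitionAtMost r → ℤ
      support   : List (PartitionAtMost m × PartitionAtMost r)
      distinct  : Unique support
      vanish    : ∀ η μ → (η , μ) ∉ support → B η μ ≡ + 0
      expansion : ∀ y z → f y z ≈
                  sumList (λ { (η , μ) → B η μ ·ℤ (sp M η y * sp L μ z) }) support

  open SymplecticExpansion public using (B)

  schurAt±1,y,z : ∀ {m r} → List ℕ → (Fin m → Unit) → (Fin r → Unit) → Carrier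
  schurAt±1,y,z p y z = schur p
    (1# ∷ - 1# ∷ tabulate (val ∘ z,z⁻¹ y) List.++ tabulate (val ∘ z,z⁻¹ z))

  ε : ∀ {t} → PrimitiveRoot t → List ℕ → List ℕ → Carrier
  ε ζ p q = skewSchur p q (rootsOfUnity ζ)

  τᶜ : ∀ {t m} → PrimitiveRoot t → (∀ η → IrreducibleSp m η) → PartitionAtMost m → Carrier
  τᶜ ζ M η = sp M η (λ i → ξ ζ ^ᵘ suc (toℕ i))

{-# OPTIONS --safe #-}

-- Evaluate s_λ at the t-th roots of unity together with z₁^±1, …, z_r^±1.  Branching s_λ over the
-- two groups of variables and restricting s_ν from GL_2r to Sp_2r gives
-- ∑_μ (∑_ν ε_{λν} b_{νμ}) sp_μ(z).  On the other hand, the roots of unity are 1, -1, ξ^±1, …, ξ^±m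
-- in some order, so symmetry of s_λ and the defining expansion of B give
-- ∑_μ (∑_η B_{ημ} τ(η)) sp_μ(z).  The functions sp_μ are linearly independent, because distinct
-- monomials are independent characters of the torus and z^μ is a highest term of sp_μ.

module Submission where

open import Algebra.Apartness.Bundles using (HeytingField)
open import Algebra.Bundles using (CommutativeRing)
import Algebra.Properties.CommutativeMonoid.Sum as CommutativeMonoidSum
import Algebra.Properties.CommutativeSemigroup as CommutativeSemigroupProperties
import Algebra.Properties.CommutativeSemiring.Exp as Exp
import Algebra.Properties.Ring as RingProperties
import Algebra.Properties.Semiring.Mult as SemiringMult
import Algebra.Properties.Semiring.Sum as SemiringSum
open import Data.Bool using (if_then_else_)
open import Data.Fin as Fin using (Fin; zero; suc; splitAt; toℕ)
import Data.Fin.Properties as Fin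
open import Data.Integer as ℤ using (ℤ; +_; -[1+_])
import Data.Integer.Properties as ℤ
import Data.Integer.Tactic.RingSolver as ℤSolver
open import Data.List using (List; []; _∷_; _++_; length; map; concatMap; tabulate; upTo; applyUpTo;
  applyDownFrom; cartesianProductWith; deduplicate; reverse)
import Data.List.Membership.DecPropositional as DecMembership
open import Data.List.Membership.Propositional using (_∈_; _∉_)
open import Data.List.Membership.Propositional.Properties
  using (∈-applyUpTo⁻; ∈-cartesianProductWith⁻; ∈-concatMap⁺; ∈-deduplicate⁺; ∈-map⁺; ∈-upTo⁺)
import Data.List.Properties as List
open import Data.List.Relation.Binary.Permutation.Propositional as ↭ using (_↭_)
import Data.List.Relation.Binary.Permutation.Propositional.Properties as ↭
open import Data.List.Relation.Binary.Pointwise as Pointwise using (Pointwise; []; _∷_)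
open import Data.List.Relation.Unary.All as All using (All; []; _∷_)
open import Data.List.Relation.Unary.Any as Any using (here; there)
open import Data.List.Relation.Unary.Linked as Linked using (Linked; []; [-]; _∷_)
open import Data.List.Relation.Unary.Unique.Propositional using (Unique; []; _∷_)
import Data.List.Relation.Unary.Unique.DecPropositional.Properties as Unique
open import Data.Nat as ℕ using (ℕ; zero; suc; _≤_; _<_; _≥_; z≤n; s≤s)
import Data.Nat.ListAction as ℕ using (sum)
import Data.Nat.Properties as ℕ
import Data.Nat.Tactic.RingSolver as ℕSolver
open import Data.Product using (∃-syntax; _×_; _,_; proj₁; proj₂)
import Data.Product.Properties as Product
open import Data.Sum using (_⊎_; inj₁; inj₂; [_,_])
import Data.Sum.Properties as Sum
open import Data.Vec as Vec using (Vec; []; _∷_)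
import Data.Vec.Properties as Vec
open import Function using (_∘_)
open import Relation.Binary.Construct.Closure.ReflexiveTransitive as Star using (Star; _◅_)
open import Relation.Binary.Definitions using (DecidableEquality; tri<; tri≈; tri>)
open import Relation.Binary.PropositionalEquality as ≡ using (_≡_; _≢_)
open import Relation.Nullary using (Dec; does; yes; no; ¬_; contradiction)
open import Relation.Nullary.Decidable using (dec-false; dec-true; recompute; _×-dec_)
open import Defs

-- The tableau definition does not show that `s_λ` is symmetric, and proving it is the main
-- combinatorial work. Branching isolates two adjacent variables, and for two variables the sum over
-- the middle partition factors row by row into symmetric terms. The coefficients to be compared lie
-- in the field, because `ε` and `τᶜ` do, so the symplectic characters must be independent over the
-- field and not only over the integers. A Heyting field has no test for zero: each cancellation
-- needs an explicit element apart from 0. In the independence argument these are positive integers,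
-- made invertible by characteristic 0: weight multiplicities, powers of 2, and the numbers 2^k - 1.
-- This is why the torus characters are separated at points all of whose coordinates are 1 except
-- for a single 2.

infix 4 _≟ˡ_

_≟ˡ_ : DecidableEquality (List ℕ)
_≟ˡ_ = List.≡-dec ℕ._≟_

-- Partitions as lists and horizontal strips

head₀ : List ℕ → ℕ
head₀ []      = 0
head₀ (a ∷ _) = a

tail₀ : List ℕ → List ℕ
tail₀ []      = []
tail₀ (_ ∷ p) = p

infixr 5 _∷₊_

-- Prepends a row, without creating a zero part (if k ≡ 0, the rest is meant to be empty).
_∷₊_ : ℕ → List ℕ → List ℕ
zero  ∷₊ p = p
suc k ∷₊ p = suc k ∷ p

Positive : List ℕ → Set
Positive = All (0 <_)

tail₀-positive : ∀ {p} → Positive p → Positive (tail₀ p)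
tail₀-positive []       = []
tail₀-positive (_ ∷ ps) = ps

IsPartition : List ℕ → Set
IsPartition p = Linked _≥_ p × Positive p

tail-isPartition : ∀ {a p} → IsPartition (a ∷ p) → IsPartition p
tail-isPartition (d , _ ∷ ps) = Linked.tail d , ps

head₀-tail≤ : ∀ {a p} → IsPartition (a ∷ p) → head₀ p ≤ a
head₀-tail≤ ([-]   , _) = z≤n
head₀-tail≤ (r ∷ _ , _) = r

-- The interlacing p₁ ≥ q₁ ≥ p₂ ≥ q₂ ≥ .... The last row is split between `drop` and `one` because a
-- row cut down to 0 is not stored.
data HorizontalStrip : List ℕ → List ℕ → Set where
  nil  : HorizontalStrip [] []
  drop : ∀ {a} → HorizontalStrip (a ∷ []) []
  one  : ∀ {a k} → 0 < k → k ≤ a → HorizontalStrip (a ∷ []) (k ∷ [])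
  cons : ∀ {a b k p q} → b ≤ k → k ≤ a →
         HorizontalStrip (b ∷ p) q → HorizontalStrip (a ∷ b ∷ p) (k ∷ q)

removeStrip⇒strip : ∀ {p q} → IsPartition p → q ∈ removeStrip p → HorizontalStrip p q
removeStrip⇒strip {[]}        _ (here ≡.refl) = nil
removeStrip⇒strip {a ∷ []}    _ (here ≡.refl) = drop
removeStrip⇒strip {a ∷ []}    _ (there q∈) with ∈-applyUpTo⁻ (λ k → suc k ∷ []) q∈
... | k , k<a , ≡.refl = one (s≤s z≤n) k<a
removeStrip⇒strip {a ∷ b ∷ p} isP q∈
  with ∈-cartesianProductWith⁻ _∷_ (applyUpTo (b ℕ.+_) (suc (a ℕ.∸ b))) (removeStrip (b ∷ p)) q∈
... | k , l , k∈ , l∈ , ≡.refl with ∈-applyUpTo⁻ (b ℕ.+_) k∈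
... | j , s≤s j≤a∸b , ≡.refl =
  cons (ℕ.m≤m+n b j)
       (ℕ.≤-trans (ℕ.+-monoʳ-≤ b j≤a∸b) (ℕ.≤-reflexive (ℕ.m+[n∸m]≡n (head₀-tail≤ isP))))
       (removeStrip⇒strip (tail-isPartition isP) l∈)


strip-head₀≤ : ∀ {p q} → HorizontalStrip p q → head₀ q ≤ head₀ p
strip-head₀≤ nil          = z≤n
strip-head₀≤ drop         = z≤n
strip-head₀≤ (one _ k≤a)  = k≤a
strip-head₀≤ (cons _ k≤a _) = k≤a

strip-sum≤ : ∀ {p q} → HorizontalStrip p q → ℕ.sum q ≤ ℕ.sum p
strip-sum≤ nil            = z≤n
strip-sum≤ drop           = z≤n
strip-sum≤ (one _ k≤a)    = ℕ.+-monoˡ-≤ 0 k≤a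
strip-sum≤ (cons _ k≤a s) = ℕ.+-mono-≤ k≤a (strip-sum≤ s)

strip-length≤ : ∀ {p q} → HorizontalStrip p q → length q ≤ length p
strip-length≤ nil          = z≤n
strip-length≤ drop         = z≤n
strip-length≤ (one _ _)    = ℕ.≤-refl
strip-length≤ (cons _ _ s) = s≤s (strip-length≤ s)

-- By interlacing, every row except the last stays at least as long as the next row of `p`, so only
-- the last can disappear.
strip-length≥ : ∀ {p q} → HorizontalStrip p q → length p ≤ suc (length q)
strip-length≥ nil          = z≤n
strip-length≥ drop         = ℕ.≤-refl
strip-length≥ (one _ _)    = s≤s z≤n
strip-length≥ (cons _ _ s) = s≤s (strip-length≥ s)

strip-isPartition : ∀ {p q} → IsPartition p → HorizontalStrip p q → IsPartition q
strip-isPartition isP nil         = isP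
strip-isPartition isP drop        = [] , []
strip-isPartition isP (one 0<k _) = [-] , 0<k ∷ []
strip-isPartition isP@(_ , _ ∷ 0<b ∷ _) (cons b≤k _ s)
  with strip-isPartition (tail-isPartition isP) s | strip-head₀≤ s
strip-isPartition {q = _ ∷ []}    isP@(_ , _ ∷ 0<b ∷ _) (cons b≤k _ s) | d , ps | h =
  [-] , ℕ.<-≤-trans 0<b b≤k ∷ ps
strip-isPartition {q = _ ∷ _ ∷ _} isP@(_ , _ ∷ 0<b ∷ _) (cons b≤k _ s) | d , ps | h =
  ℕ.≤-trans h b≤k ∷ d , ℕ.<-≤-trans 0<b b≤k ∷ ps

-- Finite sums and indicators

module Sums {c ℓ₁ ℓ₂} (F : HeytingField c ℓ₁ ℓ₂) where
  open HeytingField F hiding (_-_; zero)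
  open Characters F
  open CommutativeRing commutativeRing using (*-commutativeSemigroup; +-commutativeSemigroup)
  open import Relation.Binary.Reasoning.Setoid setoid
  module * = CommutativeSemigroupProperties *-commutativeSemigroup
  module + = CommutativeSemigroupProperties +-commutativeSemigroup

  indicator : ∀ {p} {P : Set p} → Dec P → Carrier
  indicator d = if does d then 1# else 0#

  indicator-true : ∀ {p} {P : Set p} (d : Dec P) → P → indicator d ≈ 1#
  indicator-true d p rewrite dec-true d p = refl

  indicator-false : ∀ {p} {P : Set p} (d : Dec P) → ¬ P → indicator d ≈ 0#
  indicator-false d ¬p rewrite dec-false d ¬p = refl

  indicator-⇔ : ∀ {p q} {P : Set p} {Q : Set q} (d : Dec P) (d′ : Dec Q) →
                (P → Q) → (Q → P) → indicator d ≈ indicator d′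
  indicator-⇔ (yes p) d′ f g = sym (indicator-true d′ (f p))
  indicator-⇔ (no ¬p) d′ f g = sym (indicator-false d′ (¬p ∘ g))

  indicator-× : ∀ {p q r} {P : Set p} {Q : Set q} {R : Set r}
                (d : Dec P) (d₁ : Dec Q) (d₂ : Dec R) →
                (P → Q × R) → (Q → R → P) → indicator d ≈ indicator d₁ * indicator d₂
  indicator-× d (yes q) d₂ f g =
    trans (indicator-⇔ d d₂ (proj₂ ∘ f) (g q)) (sym (*-identityˡ _))
  indicator-× d (no ¬q) d₂ f g = trans (indicator-false d (¬q ∘ proj₁ ∘ f)) (sym (zeroˡ _))

  module _ {a} {A : Set a} where

    sumList-cong-∈ : ∀ {f g : A → Carrier} xs → (∀ {i} → i ∈ xs → f i ≈ g i) →
                     sumList f xs ≈ sumList g xs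
    sumList-cong-∈ []       eq = refl
    sumList-cong-∈ (x ∷ xs) eq = +-cong (eq (here ≡.refl)) (sumList-cong-∈ xs (eq ∘ there))

    sumList-cong : ∀ {f g : A → Carrier} → (∀ i → f i ≈ g i) → ∀ xs →
                   sumList f xs ≈ sumList g xs
    sumList-cong eq xs = sumList-cong-∈ xs (λ {i} _ → eq i)

    sumList-zero : ∀ {f : A → Carrier} xs → (∀ {i} → i ∈ xs → f i ≈ 0#) → sumList f xs ≈ 0#
    sumList-zero []       eq = refl
    sumList-zero (x ∷ xs) eq =
      trans (+-cong (eq (here ≡.refl)) (sumList-zero xs (eq ∘ there))) (+-identityˡ 0#)

    sumList-+ : ∀ (f g : A → Carrier) xs →
                sumList (λ i → f i + g i) xs ≈ sumList f xs + sumList g xs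
    sumList-+ f g []       = sym (+-identityˡ 0#)
    sumList-+ f g (x ∷ xs) = trans (+-congˡ (sumList-+ f g xs)) (+.interchange _ _ _ _)

    *-sumList : ∀ a (f : A → Carrier) xs → a * sumList f xs ≈ sumList (λ i → a * f i) xs
    *-sumList a f []       = zeroʳ a
    *-sumList a f (x ∷ xs) = trans (distribˡ a _ _) (+-congˡ (*-sumList a f xs))

    sumList-* : ∀ a (f : A → Carrier) xs → sumList f xs * a ≈ sumList (λ i → f i * a) xs
    sumList-* a f xs =
      trans (*-comm _ a) (trans (*-sumList a f xs) (sumList-cong (λ i → *-comm a (f i)) xs))

    sumList-++ : ∀ (f : A → Carrier) xs ys → sumList f (xs ++ ys) ≈ sumList f xs + sumList f ys
    sumList-++ f []       ys = sym (+-identityˡ _)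
    sumList-++ f (x ∷ xs) ys = trans (+-congˡ (sumList-++ f xs ys)) (sym (+-assoc _ _ _))

  module _ {a b} {A : Set a} {B : Set b} where

    sumList-map : ∀ (f : B → Carrier) (g : A → B) xs → sumList f (map g xs) ≈ sumList (f ∘ g) xs
    sumList-map f g []       = refl
    sumList-map f g (x ∷ xs) = +-congˡ (sumList-map f g xs)

    sumList-concatMap : ∀ (f : B → Carrier) (g : A → List B) xs →
                        sumList f (concatMap g xs) ≈ sumList (λ i → sumList f (g i)) xs
    sumList-concatMap f g []       = refl
    sumList-concatMap f g (x ∷ xs) =
      trans (sumList-++ f (g x) _) (+-congˡ (sumList-concatMap f g xs))

    sumList-comm : ∀ (f : A → B → Carrier) xs ys →
                   sumList (λ i → sumList (f i) ys) xs ≈ sumList (λ j → sumList (λ i → f i j) xs) ys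
    sumList-comm f []       ys = sym (sumList-zero ys (λ _ → refl))
    sumList-comm f (x ∷ xs) ys =
      trans (+-congˡ (sumList-comm f xs ys)) (sym (sumList-+ (f x) _ ys))

  sumList-cartesianProductWith :
    ∀ {a b d} {A : Set a} {B : Set b} {D : Set d}
    (f : D → Carrier) (g : A → B → D) xs ys →
    sumList f (cartesianProductWith g xs ys) ≈ sumList (λ i → sumList (f ∘ g i) ys) xs
  sumList-cartesianProductWith f g []       ys = refl
  sumList-cartesianProductWith f g (x ∷ xs) ys =
    trans (sumList-++ f (map (g x) ys) _)
      (+-cong (sumList-map f (g x) ys) (sumList-cartesianProductWith f g xs ys))

  module _ {a} {A : Set a} (_≟_ : DecidableEquality A) where

    sumList-indicator-∉ : ∀ {k} (g : A → Carrier) {xs} → k ∉ xs →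
                          sumList (λ i → indicator (k ≟ i) * g i) xs ≈ 0#
    sumList-indicator-∉ {k} g {xs} k∉ = sumList-zero xs λ {i} i∈ →
      trans (*-congʳ (indicator-false (k ≟ i) (λ { ≡.refl → k∉ i∈ }))) (zeroˡ _)

    sumList-indicator : ∀ {k} (g : A → Carrier) {xs} → Unique xs → k ∈ xs →
                        sumList (λ i → indicator (k ≟ i) * g i) xs ≈ g k
    sumList-indicator {k} g (x# ∷ u) (here ≡.refl) =
      trans (+-cong (trans (*-congʳ (indicator-true (k ≟ k) ≡.refl)) (*-identityˡ _))
                    (sumList-indicator-∉ g (λ k∈ → All.lookup x# k∈ ≡.refl)))
            (+-identityʳ _)
    sumList-indicator {k} g {x ∷ _} (x# ∷ u) (there k∈) =
      trans (+-cong (trans (*-congʳ (indicator-false (k ≟ x) (λ { ≡.refl → All.lookup x# k∈ ≡.refl })))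
                           (zeroˡ _))
                    (sumList-indicator g u k∈))
            (+-identityˡ _)

  sumUpTo : ℕ → (ℕ → Carrier) → Carrier
  sumUpTo zero    f = 0#
  sumUpTo (suc n) f = f 0 + sumUpTo n (f ∘ suc)

  sumList-applyUpTo : ∀ {a} {A : Set a} (f : A → Carrier) g n →
                      sumList f (applyUpTo g n) ≈ sumUpTo n (f ∘ g)
  sumList-applyUpTo f g zero    = refl
  sumList-applyUpTo f g (suc n) = +-congˡ (sumList-applyUpTo f (g ∘ suc) n)

  sumUpTo-cong : ∀ n {f g : ℕ → Carrier} → (∀ i → i < n → f i ≈ g i) → sumUpTo n f ≈ sumUpTo n g
  sumUpTo-cong zero    eq = refl
  sumUpTo-cong (suc n) eq = +-cong (eq 0 (s≤s z≤n)) (sumUpTo-cong n (λ i i<n → eq (suc i) (s≤s i<n)))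

  sumUpTo-* : ∀ n (f : ℕ → Carrier) a → sumUpTo n f * a ≈ sumUpTo n (λ i → f i * a)
  sumUpTo-* zero    f a = zeroˡ a
  sumUpTo-* (suc n) f a = trans (distribʳ a _ _) (+-congˡ (sumUpTo-* n (f ∘ suc) a))

  sumUpTo-zero : ∀ n {f : ℕ → Carrier} → (∀ i → i < n → f i ≈ 0#) → sumUpTo n f ≈ 0#
  sumUpTo-zero zero    eq = refl
  sumUpTo-zero (suc n) eq =
    trans (+-cong (eq 0 (s≤s z≤n)) (sumUpTo-zero n (λ i i<n → eq (suc i) (s≤s i<n)))) (+-identityˡ 0#)

-- Strip sums row by row, and the skew Schur function of one variable

module StripSums {c ℓ₁ ℓ₂} (F : HeytingField c ℓ₁ ℓ₂) where
  open HeytingField F hiding (_-_; zero)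
  open Characters F
  open Exp commutativeSemiring using (^-homo-*; ^-congʳ)
  open Sums F
  open import Relation.Binary.Reasoning.Setoid setoid

  -- By definition `skewSchur p q (x ∷ xs)` is a `stripSum` of `skewSchur κ q xs`; leaving `G`
  -- arbitrary lets one row recursion serve all the sums below.
  stripSum : Carrier → List ℕ → (List ℕ → Carrier) → Carrier
  stripSum x p G = sumList (λ k → x ^ (ℕ.sum p ℕ.∸ ℕ.sum k) * G k) (removeStrip p)

  stripSum-cong : ∀ x {p} {G G′ : List ℕ → Carrier} → IsPartition p →
                  (∀ {q} → HorizontalStrip p q → G q ≈ G′ q) → stripSum x p G ≈ stripSum x p G′
  stripSum-cong x {p} isP eq =
    sumList-cong-∈ (removeStrip p) (λ q∈ → *-congˡ (eq (removeStrip⇒strip isP q∈)))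

  stripSum-* : ∀ a x p G → stripSum x p (λ q → a * G q) ≈ a * stripSum x p G
  stripSum-* a x p G = trans (sumList-cong (λ q → *.x∙yz≈y∙xz _ a _) (removeStrip p))
                             (sym (*-sumList a _ (removeStrip p)))

  ∸-interchange : ∀ {a k s t} → k ≤ a → t ≤ s → (a ℕ.+ s) ℕ.∸ (k ℕ.+ t) ≡ (a ℕ.∸ k) ℕ.+ (s ℕ.∸ t)
  ∸-interchange {a} {k} {s} {t} k≤a t≤s =
    ≡.trans (≡.sym (ℕ.∸-+-assoc (a ℕ.+ s) k t))
      (≡.trans (≡.cong (ℕ._∸ t) (ℕ.+-∸-comm s k≤a)) (ℕ.+-∸-assoc (a ℕ.∸ k) t≤s))

  h+j≤a : ∀ {h a j} → h ≤ a → j < suc (a ℕ.∸ h) → h ℕ.+ j ≤ a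
  h+j≤a {h} h≤a (s≤s j≤) = ℕ.≤-trans (ℕ.+-monoʳ-≤ h j≤) (ℕ.≤-reflexive (ℕ.m+[n∸m]≡n h≤a))

  positive-∷₊ : ∀ {k} → 0 < k → ∀ q → k ∷₊ q ≡ k ∷ q
  positive-∷₊ (s≤s _) q = ≡.refl

  -- Interlacing bounds each row only by two rows of the outer partition, so the first row varies
  -- independently of the others. With `_∷₊_` the last row, where 0 means deletion, needs no
  -- separate formula.
  stripSum-∷ : ∀ x {a p} → IsPartition (a ∷ p) → ∀ G →
    stripSum x (a ∷ p) G ≈
    sumUpTo (suc (a ℕ.∸ head₀ p))
      (λ j → x ^ (a ℕ.∸ (head₀ p ℕ.+ j)) * stripSum x p (λ q → G ((head₀ p ℕ.+ j) ∷₊ q)))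
  stripSum-∷ x {a} {[]} isP G = +-cong
    (trans (*-congʳ (^-congʳ x (ℕ.+-identityʳ a)))
      (*-congˡ (sym (trans (+-identityʳ _) (*-identityˡ _)))))
    (trans (sumList-applyUpTo _ (λ k → suc k ∷ []) a)
      (sumUpTo-cong a (λ i _ → *-cong
        (^-congʳ x (≡.cong₂ ℕ._∸_ (ℕ.+-identityʳ a) (ℕ.+-identityʳ (suc i))))
        (sym (trans (+-identityʳ _) (*-identityˡ _))))))
  stripSum-∷ x {a} {b ∷ p} isP@(_ , _ ∷ 0<b ∷ _) G = begin
    stripSum x (a ∷ b ∷ p) G
      ≈⟨ sumList-cartesianProductWith (λ k → x ^ (ℕ.sum (a ∷ b ∷ p) ℕ.∸ ℕ.sum k) * G k)
           (λ k l → k ∷ l) (applyUpTo (b ℕ.+_) (suc (a ℕ.∸ b))) (removeStrip (b ∷ p)) ⟩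
    sumList (λ k → sumList (λ l → x ^ (ℕ.sum (a ∷ b ∷ p) ℕ.∸ ℕ.sum (k ∷ l)) * G (k ∷ l))
                           (removeStrip (b ∷ p)))
            (applyUpTo (b ℕ.+_) (suc (a ℕ.∸ b)))
      ≈⟨ sumList-applyUpTo _ (b ℕ.+_) (suc (a ℕ.∸ b)) ⟩
    sumUpTo (suc (a ℕ.∸ b)) (λ j → sumList
      (λ l → x ^ (ℕ.sum (a ∷ b ∷ p) ℕ.∸ ℕ.sum ((b ℕ.+ j) ∷ l)) * G ((b ℕ.+ j) ∷ l))
      (removeStrip (b ∷ p)))
      ≈⟨ sumUpTo-cong (suc (a ℕ.∸ b)) step ⟩
    _ ∎
    where
    step : ∀ j → j < suc (a ℕ.∸ b) → _
    step j j< = begin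
      sumList (λ l → x ^ (ℕ.sum (a ∷ b ∷ p) ℕ.∸ ℕ.sum ((b ℕ.+ j) ∷ l)) * G ((b ℕ.+ j) ∷ l))
        (removeStrip (b ∷ p))
        ≈⟨ sumList-cong-∈ (removeStrip (b ∷ p)) (λ {l} l∈ → trans
             (*-cong (trans (^-congʳ x (∸-interchange (h+j≤a (head₀-tail≤ isP) j<)
                        (strip-sum≤ (removeStrip⇒strip (tail-isPartition isP) l∈))))
                      (^-homo-* x (a ℕ.∸ (b ℕ.+ j)) _))
               (reflexive (≡.cong G (≡.sym (positive-∷₊ (ℕ.<-≤-trans 0<b (ℕ.m≤m+n b j)) l)))))
             (*-assoc _ _ _)) ⟩
      sumList (λ l → x ^ (a ℕ.∸ (b ℕ.+ j)) *
        (x ^ (ℕ.sum (b ∷ p) ℕ.∸ ℕ.sum l) * G ((b ℕ.+ j) ∷₊ l))) (removeStrip (b ∷ p))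
        ≈⟨ *-sumList _ _ (removeStrip (b ∷ p)) ⟨
      _ ∎

  isEmpty : List ℕ → Carrier
  isEmpty []      = 1#
  isEmpty (_ ∷ _) = 0#

  -- s_{κ/ν}(y) as a product over the rows of κ.
  stripWeight : Carrier → List ℕ → List ℕ → Carrier
  stripWeight y []      ν = isEmpty ν
  stripWeight y (k ∷ κ) ν =
    indicator (head₀ κ ℕ.≤? head₀ ν) *
    ((indicator (head₀ ν ℕ.≤? k) * y ^ (k ℕ.∸ head₀ ν)) * stripWeight y κ (tail₀ ν))

  -- The condition under which `k ∷₊ q` has first row `k`: nothing may follow a zero row.
  Admissible : ℕ → List ℕ → Set
  Admissible k q = k ≡ 0 → q ≡ []

  -- A nonempty `q` forces `p` to be nonempty, and then its positive head keeps the row above from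
  -- being zero.
  strip-admissible : ∀ {p q j} → IsPartition p → HorizontalStrip p q → Admissible (head₀ p ℕ.+ j) q
  strip-admissible _ nil          _  = ≡.refl
  strip-admissible _ drop         _  = ≡.refl
  strip-admissible (_ , s≤s _ ∷ _) (one _ _)    ()
  strip-admissible (_ , s≤s _ ∷ _) (cons _ _ _) ()

  head₀-∷₊ : ∀ k {q} → Admissible k q → head₀ (k ∷₊ q) ≡ k
  head₀-∷₊ zero    adm rewrite adm ≡.refl = ≡.refl
  head₀-∷₊ (suc k) adm = ≡.refl

  -- A zero row contributes the condition `head₀ ν ≤ 0`, which for positive parts means that `ν` is
  -- empty.
  stripWeight-∷₊ : ∀ y k {κ ν} → Positive ν → Admissible k κ →
    stripWeight y (k ∷₊ κ) ν ≈ stripWeight y (k ∷ κ) ν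
  stripWeight-∷₊ y (suc k) pν adm = refl
  stripWeight-∷₊ y zero {ν = []} pν adm rewrite adm ≡.refl =
    sym (trans (*-identityˡ _) (trans (*-identityʳ _) (*-identityˡ _)))
  stripWeight-∷₊ y zero {ν = suc _ ∷ _} pν adm rewrite adm ≡.refl =
    sym (trans (*-identityˡ _) (trans (*-congʳ (zeroˡ _)) (zeroˡ _)))

  stripWeight-∷₊ y zero {ν = zero ∷ _} (() ∷ _) adm

  indicator-∷₊ : ∀ k {q ν} → Positive ν → Admissible k q →
    indicator ((k ∷₊ q) ≟ˡ ν) ≈ indicator (k ℕ.≟ head₀ ν) * indicator (q ≟ˡ tail₀ ν)
  indicator-∷₊ k pν adm = indicator-× (_ ≟ˡ _) (k ℕ.≟ _) (_ ≟ˡ _) (to k pν adm) (from k pν adm)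
    where
    to : ∀ k {q ν} → Positive ν → Admissible k q → k ∷₊ q ≡ ν → k ≡ head₀ ν × q ≡ tail₀ ν
    to zero    pν adm eq rewrite adm ≡.refl with ≡.refl ← eq = ≡.refl , ≡.refl
    to (suc k) pν adm ≡.refl = ≡.refl , ≡.refl
    from : ∀ k {q ν} → Positive ν → Admissible k q → k ≡ head₀ ν → q ≡ tail₀ ν → k ∷₊ q ≡ ν
    from k {ν = []}        pν adm ≡.refl q≡ = q≡
    from k {ν = suc _ ∷ _} pν adm ≡.refl q≡ = ≡.cong (_ ∷_) q≡
    from k {ν = zero ∷ _}  (() ∷ _) adm k≡ q≡

  -- The index runs over h ≤ i < h + n; induction on `n` raises the lower end, which is why `h`
  -- varies.
  sumUpTo-indicator : ∀ (f : ℕ → Carrier) h n k →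
    sumUpTo n (λ j → f (h ℕ.+ j) * indicator (h ℕ.+ j ℕ.≟ k)) ≈
    (indicator (h ℕ.≤? k) * indicator (k ℕ.<? h ℕ.+ n)) * f k
  sumUpTo-indicator f h zero k = sym (trans (*-congʳ (vanish (h ℕ.≤? k))) (zeroˡ _))
    where
    vanish : (d : Dec (h ≤ k)) → indicator d * indicator (k ℕ.<? h ℕ.+ 0) ≈ 0#
    vanish (no  _)   = zeroˡ _
    vanish (yes h≤k) = trans (*-congˡ (indicator-false (k ℕ.<? h ℕ.+ 0)
      (λ k<h → ℕ.<⇒≱ (≡.subst (k <_) (ℕ.+-identityʳ h) k<h) h≤k))) (zeroʳ _)
  sumUpTo-indicator f h (suc n) k = begin
    f (h ℕ.+ 0) * indicator (h ℕ.+ 0 ℕ.≟ k)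
        + sumUpTo n (λ j → f (h ℕ.+ suc j) * indicator (h ℕ.+ suc j ℕ.≟ k))
      ≈⟨ +-cong (reflexive (≡.cong (λ i → f i * indicator (i ℕ.≟ k)) (ℕ.+-identityʳ h)))
           (sumUpTo-cong n (λ j _ → reflexive (≡.cong (λ i → f i * indicator (i ℕ.≟ k))
               (ℕ.+-suc h j)))) ⟩
    f h * indicator (h ℕ.≟ k) + sumUpTo n (λ j → f (suc h ℕ.+ j) * indicator (suc h ℕ.+ j ℕ.≟ k))
      ≈⟨ +-congˡ (sumUpTo-indicator f (suc h) n k) ⟩
    f h * indicator (h ℕ.≟ k) + (indicator (suc h ℕ.≤? k) * indicator (k ℕ.<? suc h ℕ.+ n)) * f k
      ≈⟨ +-congˡ (*-congʳ (*-congˡ (reflexive (≡.cong (λ m → indicator (k ℕ.<? m))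
          (≡.sym (ℕ.+-suc h n)))))) ⟩
    f h * indicator (h ℕ.≟ k) + (indicator (suc h ℕ.≤? k) * indicator (k ℕ.<? h ℕ.+ suc n)) * f k
      ≈⟨ split (h ℕ.≟ k) ⟩
    (indicator (h ℕ.≤? k) * indicator (k ℕ.<? h ℕ.+ suc n)) * f k ∎
    where
    split : (d : Dec (h ≡ k)) → f h * indicator d +
        (indicator (suc h ℕ.≤? k) * indicator (k ℕ.<? h ℕ.+ suc n)) * f k
            ≈ (indicator (h ℕ.≤? k) * indicator (k ℕ.<? h ℕ.+ suc n)) * f k
    split (yes ≡.refl) = begin
      f h * 1# + (indicator (suc h ℕ.≤? h) * _) * f h
        ≈⟨ +-cong (*-comm _ _) (trans (*-congʳ
            (trans (*-congʳ (indicator-false (suc h ℕ.≤? h) ℕ.1+n≰n)) (zeroˡ _))) (zeroˡ _)) ⟩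
      1# * f h + 0#
        ≈⟨ +-identityʳ _ ⟩
      1# * f h
        ≈⟨ *-congʳ (trans (*-cong (indicator-true (h ℕ.≤? h) ℕ.≤-refl)
             (indicator-true (h ℕ.<? h ℕ.+ suc n) (ℕ.m<m+n h (s≤s z≤n)))) (*-identityˡ 1#)) ⟨
      _ ∎
    split (no h≢k) = trans (+-cong (zeroʳ _) (*-congʳ (*-congʳ
        (indicator-⇔ (suc h ℕ.≤? k) (h ℕ.≤? k) ℕ.<⇒≤ (λ h≤k → ℕ.≤∧≢⇒< h≤k h≢k)))))
      (+-identityˡ _)

  -- The indicator collapses the sum over the first row to the value `head₀ ν`, and the range of
  -- that sum becomes the two interlacing inequalities.
  skewSchur₁ : ∀ y {κ ν} → IsPartition κ → Positive ν →
               skewSchur κ ν (y ∷ []) ≈ stripWeight y κ ν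
  skewSchur₁ y {[]} {[]}    isP pν = trans (+-identityʳ _) (*-identityˡ _)
  skewSchur₁ y {[]} {_ ∷ _} isP pν = trans (+-identityʳ _) (*-identityˡ _)
  skewSchur₁ y {k ∷ κ} {ν} isP pν = begin
    stripSum y (k ∷ κ) (λ q → indicator (q ≟ˡ ν))
      ≈⟨ stripSum-∷ y isP _ ⟩
    sumUpTo (suc (k ℕ.∸ h)) (λ j → y ^ (k ℕ.∸ (h ℕ.+ j))
        * stripSum y κ (λ q → indicator (((h ℕ.+ j) ∷₊ q) ≟ˡ ν)))
      ≈⟨ sumUpTo-cong (suc (k ℕ.∸ h)) (λ j _ → trans (*-congˡ (trans
           (stripSum-cong y (tail-isPartition isP)
               (λ s → indicator-∷₊ (h ℕ.+ j) pν (strip-admissible (tail-isPartition isP) s)))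
           (trans (stripSum-* _ y κ _) (*-congˡ
               (skewSchur₁ y (tail-isPartition isP) (tail₀-positive pν))))))
           (sym (*-assoc (y ^ (k ℕ.∸ (h ℕ.+ j))) _ _))) ⟩
    sumUpTo (suc (k ℕ.∸ h)) (λ j → (y ^ (k ℕ.∸ (h ℕ.+ j)) * indicator (h ℕ.+ j ℕ.≟ head₀ ν)) *
        stripWeight y κ (tail₀ ν))
      ≈⟨ sumUpTo-* (suc (k ℕ.∸ h)) (λ j → y ^ (k ℕ.∸ (h ℕ.+ j)) * indicator (h ℕ.+ j ℕ.≟ head₀ ν)) _ ⟨
    sumUpTo (suc (k ℕ.∸ h)) (λ j → y ^ (k ℕ.∸ (h ℕ.+ j)) * indicator (h ℕ.+ j ℕ.≟ head₀ ν)) *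
        stripWeight y κ (tail₀ ν)
      ≈⟨ *-congʳ (sumUpTo-indicator (λ i → y ^ (k ℕ.∸ i)) h (suc (k ℕ.∸ h)) (head₀ ν)) ⟩
    ((indicator (h ℕ.≤? head₀ ν) * indicator (head₀ ν ℕ.<? h ℕ.+ suc (k ℕ.∸ h)))
        * y ^ (k ℕ.∸ head₀ ν)) * stripWeight y κ (tail₀ ν)
      -- The range of the first row ends at `k`, so its exclusive end is `suc k`.
      ≈⟨ *-congʳ (*-congʳ (*-congˡ (trans (reflexive (≡.cong (λ m → indicator (head₀ ν ℕ.<? m)) top))
           (indicator-⇔ (head₀ ν ℕ.<? suc k) (head₀ ν ℕ.≤? k) ℕ.s≤s⁻¹ s≤s)))) ⟩
    ((indicator (h ℕ.≤? head₀ ν) * indicator (head₀ ν ℕ.≤? k)) * y ^ (k ℕ.∸ head₀ ν))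
        * stripWeight y κ (tail₀ ν)
      ≈⟨ trans (*-congʳ (*-assoc _ _ _)) (*-assoc _ _ _) ⟩
    stripWeight y (k ∷ κ) ν ∎
    where
    h = head₀ κ
    top : h ℕ.+ suc (k ℕ.∸ h) ≡ suc k
    top = ≡.trans (ℕ.+-suc h _) (≡.cong suc (ℕ.m+[n∸m]≡n (head₀-tail≤ isP)))

-- Symmetry in two variables

module TwoVariables {c ℓ₁ ℓ₂} (F : HeytingField c ℓ₁ ℓ₂) where
  open HeytingField F hiding (_-_; zero)
  open Characters F
  open Exp commutativeSemiring using (^-homo-*; ^-congʳ)
  open Sums F
  open StripSums F
  open import Relation.Binary.Reasoning.Setoid setoid

  -- The complete homogeneous polynomial of degree n - 1, indexed by its number of terms so that an
  -- empty range gives 0.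
  complete : ℕ → Carrier → Carrier → Carrier
  complete zero    x y = 0#
  complete (suc n) x y = x ^ n + y * complete n x y

  -- The defining recursion with the roles of `x` and `y` exchanged; having both yields symmetry by
  -- induction.
  complete-suc : ∀ n x y → complete (suc n) x y ≈ x * complete n x y + y ^ n
  complete-suc zero    x y = trans (+-cong refl (zeroʳ y)) (trans (+-comm _ _) (+-congʳ (sym (zeroʳ x))))
  complete-suc (suc n) x y = begin
    x * x ^ n + y * complete (suc n) x y           ≈⟨ +-congˡ (*-congˡ (complete-suc n x y)) ⟩
    x * x ^ n + y * (x * complete n x y + y ^ n)
        ≈⟨ +-congˡ (trans (distribˡ y _ _) (+-congʳ (*.x∙yz≈y∙xz y x _))) ⟩
    x * x ^ n + (x * (y * complete n x y) + y * y ^ n) ≈⟨ +-assoc _ _ _ ⟨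
    (x * x ^ n + x * (y * complete n x y)) + y * y ^ n ≈⟨ +-congʳ (distribˡ x _ _) ⟨
    x * complete (suc n) x y + y ^ suc n           ∎

  complete-comm : ∀ n x y → complete n x y ≈ complete n y x
  complete-comm zero    x y = refl
  complete-comm (suc n) x y =
    trans (complete-suc n x y) (trans (+-comm _ _) (+-congˡ (*-congˡ (complete-comm n x y))))

  -- The contribution of a row of length `k` in the middle partition: `a` and `c` are the same row
  -- of the outer and inner partitions, and `u` is the bound coming from the previous inner row.
  column : ∀ (x y : Carrier) (a c u k : ℕ) → Carrier
  column x y a c u k = x ^ (a ℕ.∸ k) * (indicator (k ℕ.≤? u) * (indicator (c ℕ.≤? k) * y ^ (k ℕ.∸ c)))

  column-vanish-upper : ∀ x y a c u {k} → ¬ k ≤ u → column x y a c u k ≈ 0#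
  column-vanish-upper x y a c u {k} k≰u = 
    trans (*-congˡ (trans (*-congʳ (indicator-false (k ℕ.≤? u) k≰u)) (zeroˡ _))) (zeroʳ _)

  column-vanish-lower : ∀ x y a c u {k} → ¬ c ≤ k → column x y a c u k ≈ 0#
  column-vanish-lower x y a c u {k} c≰k = trans (*-congˡ (trans (*-congˡ
    (trans (*-congʳ (indicator-false (c ℕ.≤? k) c≰k)) (zeroˡ _))) (zeroʳ _))) (zeroʳ _)

  -- The nonzero terms have max(h, c) ≤ k ≤ min(a, u). All of them share the power of `x` at the
  -- upper end, `a ∸ u`, and the power of `y` at the lower end, `h ∸ c`; what is left is a complete
  -- homogeneous sum.
  columnSum : ∀ x y a c u h n → h ℕ.+ n ≡ suc a →
    sumUpTo n (λ j → column x y a c u (h ℕ.+ j)) ≈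
    x ^ (a ℕ.∸ u) * (y ^ (h ℕ.∸ c) * complete (suc (a ℕ.⊓ u) ℕ.∸ (h ℕ.⊔ c)) x y)
  columnSum x y a c u h zero eq = sym (trans (*-congˡ (trans (*-congˡ
    (reflexive (≡.cong (λ n → complete n x y) (ℕ.m≤n⇒m∸n≡0 empty)))) (zeroʳ _))) (zeroʳ _))
    where
    empty : suc (a ℕ.⊓ u) ≤ h ℕ.⊔ c
    empty = ℕ.≤-trans (s≤s (ℕ.m⊓n≤m a u))
      (ℕ.≤-trans (ℕ.≤-reflexive (≡.trans (≡.sym eq) (ℕ.+-identityʳ h))) (ℕ.m≤m⊔n h c))
  columnSum x y a c u h (suc n) eq = begin
    column x y a c u (h ℕ.+ 0) + sumUpTo n (λ j → column x y a c u (h ℕ.+ suc j))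
      ≈⟨ +-cong (reflexive (≡.cong (column x y a c u) (ℕ.+-identityʳ h)))
           (sumUpTo-cong n (λ j _ → reflexive (≡.cong (column x y a c u) (ℕ.+-suc h j)))) ⟩
    column x y a c u h + sumUpTo n (λ j → column x y a c u (suc h ℕ.+ j))
      ≈⟨ +-congˡ (columnSum x y a c u (suc h) n eq′) ⟩
    column x y a c u h + x ^ (a ℕ.∸ u) * (y ^ (suc h ℕ.∸ c)
        * complete (suc (a ℕ.⊓ u) ℕ.∸ (suc h ℕ.⊔ c)) x y)
      ≈⟨ step (c ℕ.≤? h) (h ℕ.≤? u) ⟩
    _ ∎
    where
    eq′ : suc h ℕ.+ n ≡ suc a
    eq′ = ≡.trans (≡.sym (ℕ.+-suc h n)) eq
    h≤a : h ≤ a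
    h≤a = ℕ.≤-trans (ℕ.m≤m+n h n) (ℕ.≤-reflexive (ℕ.suc-injective eq′))
    step : Dec (c ≤ h) → Dec (h ≤ u) →
      column x y a c u h + x ^ (a ℕ.∸ u) * (y ^ (suc h ℕ.∸ c)
          * complete (suc (a ℕ.⊓ u) ℕ.∸ (suc h ℕ.⊔ c)) x y)
      ≈ x ^ (a ℕ.∸ u) * (y ^ (h ℕ.∸ c) * complete (suc (a ℕ.⊓ u) ℕ.∸ (h ℕ.⊔ c)) x y)
    -- Below `c` the term vanishes, and raising `h` changes neither `h ⊔ c` nor `h ∸ c`.
    step (no c≰h) _ = trans (+-congʳ (column-vanish-lower x y a c u c≰h)) (trans (+-identityˡ _)
      (*-congˡ (*-cong
        (^-congʳ y (≡.trans (ℕ.m≤n⇒m∸n≡0 h<c) (≡.sym (ℕ.m≤n⇒m∸n≡0 (ℕ.<⇒≤ h<c)))))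
        (reflexive (≡.cong (λ m → complete (suc (a ℕ.⊓ u) ℕ.∸ m) x y)
          (≡.trans (ℕ.m≤n⇒m⊔n≡n h<c) (≡.sym (ℕ.m≤n⇒m⊔n≡n (ℕ.<⇒≤ h<c)))))))))
      where
      h<c = ℕ.≰⇒> c≰h
    -- Once the lower end exceeds `u`, the range is empty both before and after raising it.
    step (yes _) (no h≰u) = trans (+-congʳ (column-vanish-upper x y a c u h≰u)) (trans (+-identityˡ _)
      (trans (vanish (suc h) (ℕ.n≤1+n h)) (sym (vanish h ℕ.≤-refl))))
      where
      vanish : ∀ h′ → h ≤ h′ →
        x ^ (a ℕ.∸ u) * (y ^ (h′ ℕ.∸ c) * complete (suc (a ℕ.⊓ u) ℕ.∸ (h′ ℕ.⊔ c)) x y) ≈ 0#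
      vanish h′ h≤h′ = trans (*-congˡ (trans (*-congˡ (reflexive (≡.cong (λ n → complete n x y)
        (ℕ.m≤n⇒m∸n≡0 (ℕ.≤-trans (s≤s (ℕ.m⊓n≤n a u))
          (ℕ.≤-trans (ℕ.≰⇒> h≰u) (ℕ.≤-trans h≤h′ (ℕ.m≤m⊔n h′ c)))))))) (zeroʳ _))) (zeroʳ _)
    -- The term at `k = h` supplies the summand `x ^ N` of `complete (suc N) x y`; raising the lower
    -- end costs the rest one factor `y`, as in the defining recursion.
    step (yes c≤h) (yes h≤u) = begin
      column x y a c u h + x ^ (a ℕ.∸ u) * (y ^ (suc h ℕ.∸ c)
          * complete (suc (a ℕ.⊓ u) ℕ.∸ (suc h ℕ.⊔ c)) x y)
        ≈⟨ +-cong
             (*-cong (trans (^-congʳ x exponent) (^-homo-* x (a ℕ.∸ u) N))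
               (trans (*-congʳ (indicator-true (h ℕ.≤? u) h≤u)) (trans (*-identityˡ _)
                 (trans (*-congʳ (indicator-true (c ℕ.≤? h) c≤h)) (*-identityˡ _)))))
             (*-congˡ (*-cong (^-congʳ y (ℕ.+-∸-assoc 1 c≤h))
               (reflexive (≡.cong (λ m → complete (suc (a ℕ.⊓ u) ℕ.∸ m) x y)
                   (ℕ.m≥n⇒m⊔n≡m (ℕ.m≤n⇒m≤1+n c≤h)))))) ⟩
      (x ^ (a ℕ.∸ u) * x ^ N) * y ^ (h ℕ.∸ c) + x ^ (a ℕ.∸ u) * ((y * y ^ (h ℕ.∸ c)) * complete N x y)
        ≈⟨ +-cong (trans (*-assoc _ _ _) (*-congˡ (*-comm _ _)))
            (*-congˡ (trans (*-congʳ (*-comm _ _)) (*-assoc _ _ _))) ⟩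
      x ^ (a ℕ.∸ u) * (y ^ (h ℕ.∸ c) * x ^ N) + x ^ (a ℕ.∸ u) * (y ^ (h ℕ.∸ c) * (y * complete N x y))
        ≈⟨ trans (*-congˡ (distribˡ _ _ _)) (distribˡ _ _ _) ⟨
      x ^ (a ℕ.∸ u) * (y ^ (h ℕ.∸ c) * complete (suc N) x y)
        ≈⟨ *-congˡ (*-congˡ (reflexive (≡.cong (λ m → complete m x y) count))) ⟨
      _ ∎
      where
      N = (a ℕ.⊓ u) ℕ.∸ h
      h≤a⊓u : h ≤ a ℕ.⊓ u
      h≤a⊓u = ℕ.⊓-glb h≤a h≤u
      count : suc (a ℕ.⊓ u) ℕ.∸ (h ℕ.⊔ c) ≡ suc N
      count = ≡.trans (≡.cong (suc (a ℕ.⊓ u) ℕ.∸_) (ℕ.m≥n⇒m⊔n≡m c≤h)) (ℕ.+-∸-assoc 1 h≤a⊓u)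
      a≡ : a ≡ (a ℕ.∸ u) ℕ.+ (a ℕ.⊓ u)
      a≡ = ≡.sym (≡.trans (ℕ.+-comm (a ℕ.∸ u) _)
          (≡.trans (≡.cong (ℕ._+ (a ℕ.∸ u)) (ℕ.⊓-comm a u)) (ℕ.m⊓n+n∸m≡n u a)))
      exponent : a ℕ.∸ h ≡ (a ℕ.∸ u) ℕ.+ N
      exponent = ≡.trans (≡.cong (ℕ._∸ h) a≡) (ℕ.+-∸-assoc (a ℕ.∸ u) h≤a⊓u)

  -- For fixed ν the rows of the middle partition vary independently, once the bound u = ν_{i-1} on
  -- row i is recorded.  Row i contributes a complete homogeneous polynomial in x, y times
  -- x^(p_i ∸ u) y^(p_{i+1} ∸ ν_i); this power of y matches the power of x from the next row.
  boundedPair : Carrier → Carrier → ℕ → List ℕ → List ℕ → Carrier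
  boundedPair x y u p ν = stripSum x p (λ κ → indicator (head₀ κ ℕ.≤? u) * stripWeight y κ ν)

  boundedPair-∷ : ∀ x y u {a p ν} → IsPartition (a ∷ p) → Positive ν →
    boundedPair x y u (a ∷ p) ν ≈
    sumUpTo (suc (a ℕ.∸ head₀ p)) (λ j → column x y a (head₀ ν) u (head₀ p ℕ.+ j)) *
    boundedPair x y (head₀ ν) p (tail₀ ν)
  boundedPair-∷ x y u {a} {p} {ν} isP pν = begin
    boundedPair x y u (a ∷ p) ν
      ≈⟨ stripSum-∷ x isP _ ⟩
    sumUpTo (suc (a ℕ.∸ h)) (λ j → x ^ (a ℕ.∸ (h ℕ.+ j)) *
      stripSum x p (λ κ → indicator (head₀ ((h ℕ.+ j) ∷₊ κ) ℕ.≤? u) * stripWeight y ((h ℕ.+ j) ∷₊ κ) ν))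
      ≈⟨ sumUpTo-cong (suc (a ℕ.∸ h)) (λ j _ → trans
           (*-congˡ (trans (stripSum-cong x (tail-isPartition isP)
               (λ s → row (h ℕ.+ j) (strip-admissible (tail-isPartition isP) s)))
             (stripSum-* _ x p _)))
           (sym (*-assoc (x ^ (a ℕ.∸ (h ℕ.+ j))) _ _))) ⟩
    sumUpTo (suc (a ℕ.∸ h)) (λ j → column x y a (head₀ ν) u (h ℕ.+ j)
        * boundedPair x y (head₀ ν) p (tail₀ ν))
      ≈⟨ sumUpTo-* (suc (a ℕ.∸ h)) (λ j → column x y a (head₀ ν) u (h ℕ.+ j)) _ ⟨
    _ ∎
    where
    h = head₀ p
    -- The condition in `stripWeight` that the next row of `κ` is at most `head₀ ν` is handed on as
    -- the bound for the remaining rows, which turns the sum into a product.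
    row : ∀ k {κ} → Admissible k κ →
      indicator (head₀ (k ∷₊ κ) ℕ.≤? u) * stripWeight y (k ∷₊ κ) ν ≈
      (indicator (k ℕ.≤? u) * (indicator (head₀ ν ℕ.≤? k) * y ^ (k ℕ.∸ head₀ ν))) *
      (indicator (head₀ κ ℕ.≤? head₀ ν) * stripWeight y κ (tail₀ ν))
    row k {κ} adm = trans
      (*-cong (reflexive (≡.cong (λ m → indicator (m ℕ.≤? u)) (head₀-∷₊ k adm)))
          (stripWeight-∷₊ y k pν adm))
      (trans (*-congˡ (*.x∙yz≈y∙xz _ _ _)) (sym (*-assoc _ _ _)))

  symmetricPart : Carrier → Carrier → ℕ → List ℕ → List ℕ → Carrier
  symmetricPart x y u []      ν = isEmpty ν
  symmetricPart x y u (a ∷ p) ν =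
    (complete (suc (a ℕ.⊓ u) ℕ.∸ (head₀ p ℕ.⊔ head₀ ν)) x y *
     (x ^ (head₀ p ℕ.∸ head₀ ν) * y ^ (head₀ p ℕ.∸ head₀ ν))) *
    symmetricPart x y (head₀ ν) p (tail₀ ν)

  symmetricPart-comm : ∀ x y u p ν → symmetricPart x y u p ν ≈ symmetricPart y x u p ν
  symmetricPart-comm x y u []      ν = refl
  symmetricPart-comm x y u (a ∷ p) ν = *-cong
    (*-cong (complete-comm (suc (a ℕ.⊓ u) ℕ.∸ (head₀ p ℕ.⊔ head₀ ν)) x y) (*-comm _ _))
    (symmetricPart-comm x y (head₀ ν) p (tail₀ ν))

  boundedPair-factor : ∀ x y u {p ν} → IsPartition p → Positive ν →
    boundedPair x y u p ν ≈ x ^ (head₀ p ℕ.∸ u) * symmetricPart x y u p ν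
  boundedPair-factor x y u {[]} {ν} isP pν = trans (+-identityʳ _) (*-cong
    (^-congʳ x (≡.sym (ℕ.0∸n≡0 u))) (*-identityˡ _))
  boundedPair-factor x y u {a ∷ p} {ν} isP pν = begin
    boundedPair x y u (a ∷ p) ν
      ≈⟨ boundedPair-∷ x y u isP pν ⟩
    sumUpTo (suc (a ℕ.∸ head₀ p)) (λ j → column x y a (head₀ ν) u (head₀ p ℕ.+ j)) *
      boundedPair x y (head₀ ν) p (tail₀ ν)
      ≈⟨ *-cong (columnSum x y a (head₀ ν) u (head₀ p) _
                  (≡.trans (ℕ.+-suc (head₀ p) _) (≡.cong suc (ℕ.m+[n∸m]≡n (head₀-tail≤ isP)))))
                (boundedPair-factor x y (head₀ ν) (tail-isPartition isP) (tail₀-positive pν)) ⟩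
    (x ^ (a ℕ.∸ u) * (Y * H)) * (X * S)
      ≈⟨ *-assoc _ _ _ ⟩
    x ^ (a ℕ.∸ u) * ((Y * H) * (X * S))
      ≈⟨ *-congˡ (trans (*-congʳ (*-comm Y H)) (trans (sym (*-assoc _ X S))
           (*-congʳ (trans (*-assoc H Y X) (*-congˡ (*-comm Y X)))))) ⟩
    x ^ (a ℕ.∸ u) * ((H * (X * Y)) * S)
      ∎
    where
    X = x ^ (head₀ p ℕ.∸ head₀ ν)
    Y = y ^ (head₀ p ℕ.∸ head₀ ν)
    H = complete (suc (a ℕ.⊓ u) ℕ.∸ (head₀ p ℕ.⊔ head₀ ν)) x y
    S = symmetricPart x y (head₀ ν) p (tail₀ ν)

  -- With `u = head₀ p` the bound on the first row always holds and the one unmatched power of `x`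
  -- has exponent 0, so only symmetric factors remain.
  skewSchur₂ : ∀ x y {p ν} → IsPartition p → Positive ν →
    skewSchur p ν (x ∷ y ∷ []) ≈ symmetricPart x y (head₀ p) p ν
  skewSchur₂ x y {p} {ν} isP pν = begin
    stripSum x p (λ κ → skewSchur κ ν (y ∷ []))
      ≈⟨ stripSum-cong x isP (λ {κ} s → trans (skewSchur₁ y (strip-isPartition isP s) pν)
           (sym (trans (*-congʳ (indicator-true (head₀ κ ℕ.≤? head₀ p) (strip-head₀≤ s)))
               (*-identityˡ _)))) ⟩
    boundedPair x y (head₀ p) p ν
      ≈⟨ boundedPair-factor x y (head₀ p) isP pν ⟩
    x ^ (head₀ p ℕ.∸ head₀ p) * symmetricPart x y (head₀ p) p ν
      ≈⟨ trans (*-congʳ (^-congʳ x (ℕ.n∸n≡0 (head₀ p)))) (*-identityˡ _) ⟩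
    symmetricPart x y (head₀ p) p ν ∎

  skewSchur₂-comm : ∀ x y {p ν} → IsPartition p → Positive ν →
    skewSchur p ν (x ∷ y ∷ []) ≈ skewSchur p ν (y ∷ x ∷ [])
  skewSchur₂-comm x y {p} isP pν = trans (skewSchur₂ x y isP pν)
    (trans (symmetricPart-comm x y (head₀ p) p _) (sym (skewSchur₂ y x isP pν)))

-- Finite lists of the partitions in a rectangle

isPartition? : ∀ p → Dec (IsPartition p)
isPartition? p = Linked.linked? ℕ._≥?_ p ×-dec All.all? (0 ℕ.<?_) p

parts-isPartition : ∀ p → IsPartition (parts p)
parts-isPartition (mkPartition p d ps) = recompute (isPartition? p) (d , ps)

partsOf-length≤ : ∀ {n} (ν : PartitionAtMost n) → length (partsOf ν) ≤ n
partsOf-length≤ {n} (mkPartitionAtMost ν l) = recompute (length (parts ν) ℕ.≤? n) l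

-- Candidate lists that fail the test, such as those with a zero part, go to the empty partition;
-- `deduplicate` later removes the repetitions.
toPartition : ∀ n p → Dec (IsPartition p × length p ≤ n) → PartitionAtMost n
toPartition n p (yes ((d , ps) , b)) = mkPartitionAtMost (mkPartition p d ps) b
toPartition n p (no _)               = mkPartitionAtMost (mkPartition [] [] []) z≤n

toPartition-partsOf : ∀ {n} ν d → toPartition n (partsOf ν) d ≡ ν
toPartition-partsOf ν (yes _) = ≡.refl
toPartition-partsOf ν (no ¬p) = contradiction (parts-isPartition (partition ν) , partsOf-length≤ ν) ¬p

decreasingLists : ℕ → ℕ → List (List ℕ)
decreasingLists zero    N = [] ∷ []
decreasingLists (suc n) N =
  [] ∷ concatMap (λ k → map (k ∷_) (decreasingLists n k)) (upTo (suc N))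

∈-decreasingLists : ∀ n {N p} → IsPartition p → length p ≤ n → head₀ p ≤ N → p ∈ decreasingLists n N
∈-decreasingLists zero    {p = []}    _   _         _   = here ≡.refl
∈-decreasingLists (suc n) {p = []}    _   _         _   = here ≡.refl
∈-decreasingLists (suc n) {p = a ∷ p} isP (s≤s len) a≤N =
  there (∈-concatMap⁺ (λ k → map (k ∷_) (decreasingLists n k))
    (Any.map (λ { ≡.refl → ∈-map⁺ (a ∷_) (∈-decreasingLists n (tail-isPartition isP) len
        (head₀-tail≤ isP)) })
             (∈-upTo⁺ (s≤s a≤N))))

-- The partitions with at most `n` rows, each at most `N`. Removing strips never leaves such a
-- rectangle, so one list serves every intermediate partition.
partitionsIn : ∀ n → ℕ → List (PartitionAtMost n)
partitionsIn n N = deduplicate _≟ᴾ_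
  (map (λ p → toPartition n p (isPartition? p ×-dec length p ℕ.≤? n)) (decreasingLists n N))

partitionsIn-unique : ∀ n N → Unique (partitionsIn n N)
partitionsIn-unique n N = Unique.deduplicate-! _≟ᴾ_ _

∈-partitionsIn : ∀ {n N} (ν : PartitionAtMost n) → head₀ (partsOf ν) ≤ N → ν ∈ partitionsIn n N
∈-partitionsIn {n} {N} ν h = ∈-deduplicate⁺ _≟ᴾ_
  (≡.subst (_∈ map _ (decreasingLists n N)) (toPartition-partsOf ν _)
    (∈-map⁺ (λ p → toPartition n p (isPartition? p ×-dec length p ℕ.≤? n))
      (∈-decreasingLists n (parts-isPartition (partition ν)) (partsOf-length≤ ν) h)))

-- Branching and symmetry of skew Schur functions

module SchurFunctions {c ℓ₁ ℓ₂} (F : HeytingField c ℓ₁ ℓ₂) where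
  open HeytingField F hiding (_-_; zero)
  open Characters F
  open Exp commutativeSemiring using (^-congˡ)
  open Sums F
  open StripSums F
  open TwoVariables F
  open import Relation.Binary.Reasoning.Setoid setoid

  -- The recursion of `skewSchur` with the final indicator replaced by an arbitrary function of the
  -- last partition.
  chain : (List ℕ → Carrier) → List ℕ → List Carrier → Carrier
  chain g p []       = g p
  chain g p (x ∷ xs) = stripSum x p (λ q → chain g q xs)

  skewSchur-++ : ∀ p q xs ys → skewSchur p q (xs ++ ys) ≈ chain (λ κ → skewSchur κ q ys) p xs
  skewSchur-++ p q []       ys = refl
  skewSchur-++ p q (x ∷ xs) ys =
    sumList-cong (λ κ → *-congˡ (skewSchur-++ κ q xs ys)) (removeStrip p)

  -- A sum of indicators is inserted at the last partition, and linearity moves it outside. `P` is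
  -- an invariant of strip removal: branching bounds only the first row by it, the exchange of two
  -- variables also the number of rows.
  chain-expand : ∀ n N (P : List ℕ → Set) →
    (∀ {p} → P p → IsPartition p × head₀ p ≤ N) →
    (∀ {p q} → P p → HorizontalStrip p q → P q) →
    (g : List ℕ → Carrier) → (∀ {p} → P p → n < length p → g p ≈ 0#) →
    ∀ xs {p} → P p →
    chain g p xs ≈ sumList (λ ν → skewSchur p (partsOf ν) xs * g (partsOf ν)) (partitionsIn n N)
  chain-expand n N P box closed g vanish [] {p} Pp with length p ℕ.≤? n
  ... | no p≰n = trans (vanish Pp (ℕ.≰⇒> p≰n)) (sym (sumList-zero (partitionsIn n N) λ {ν} _ →
    trans (*-congʳ (indicator-false (p ≟ˡ partsOf ν) (λ { ≡.refl → p≰n (partsOf-length≤ ν) })))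
        (zeroˡ _)))
  ... | yes p≤n = sym (trans
    (sumList-cong (λ ν → *-congʳ (indicator-⇔ (p ≟ˡ partsOf ν) (π ≟ᴾ ν) (λ { ≡.refl → ≡.refl })
        (λ { ≡.refl → ≡.refl })))
      (partitionsIn n N))
    (sumList-indicator _≟ᴾ_ (g ∘ partsOf) (partitionsIn-unique n N) (∈-partitionsIn π (proj₂ (box Pp)))))
    where
    π : PartitionAtMost n
    π = mkPartitionAtMost (mkPartition p (proj₁ (proj₁ (box Pp))) (proj₂ (proj₁ (box Pp)))) p≤n
  chain-expand n N P box closed g vanish (x ∷ xs) {p} Pp = begin
    stripSum x p (λ q → chain g q xs)
      ≈⟨ stripSum-cong x (proj₁ (box Pp)) (λ s → chain-expand n N P box closed g vanish xs
          (closed Pp s)) ⟩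
    stripSum x p (λ q → sumList (λ ν → skewSchur q (partsOf ν) xs * g (partsOf ν)) T)
      ≈⟨ sumList-cong (λ q → trans (*-sumList _ _ T) (sumList-cong (λ ν → sym (*-assoc _ _ _)) T))
          (removeStrip p) ⟩
    sumList (λ q → sumList (λ ν → (w q * skewSchur q (partsOf ν) xs) * g (partsOf ν)) T) (removeStrip p)
      ≈⟨ sumList-comm (λ q ν → (w q * skewSchur q (partsOf ν) xs) * g (partsOf ν)) (removeStrip p) T ⟩
    sumList (λ ν → sumList (λ q → (w q * skewSchur q (partsOf ν) xs) * g (partsOf ν)) (removeStrip p)) T
      ≈⟨ sumList-cong (λ ν → sumList-* (g (partsOf ν)) (λ q → w q * skewSchur q (partsOf ν) xs)
          (removeStrip p)) T ⟨
    sumList (λ ν → skewSchur p (partsOf ν) (x ∷ xs) * g (partsOf ν)) T ∎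
    where
    T = partitionsIn n N
    w : List ℕ → Carrier
    w q = x ^ (ℕ.sum p ℕ.∸ ℕ.sum q)

  -- Strips never lengthen the first row, so such a `ν` cannot be reached; this makes the sum over
  -- `ν` in the theorem finite.
  skewSchur-vanish : ∀ {N} xs {p ν} → IsPartition p → head₀ p ≤ N → ¬ head₀ ν ≤ N → skewSchur p ν xs ≈ 0#
  skewSchur-vanish []       {p} {ν} isP h ν≰ = indicator-false (p ≟ˡ ν) (λ { ≡.refl → ν≰ h })
  skewSchur-vanish (x ∷ xs) {p} {ν} isP h ν≰ = sumList-zero (removeStrip p) λ q∈ →
    let s = removeStrip⇒strip isP q∈ in
    trans (*-congˡ (skewSchur-vanish xs (strip-isPartition isP s) (ℕ.≤-trans (strip-head₀≤ s) h)
        ν≰)) (zeroʳ _)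

  -- Each variable removes at most one row, so the empty partition is out of reach.
  schur-length : ∀ xs {p} → IsPartition p → length xs < length p → schur p xs ≈ 0#
  schur-length []       {p} isP l = indicator-false (p ≟ˡ []) (λ { ≡.refl → ℕ.n≮0 l })
  schur-length (x ∷ xs) {p} isP l = sumList-zero (removeStrip p) λ q∈ →
    let s = removeStrip⇒strip isP q∈ in
    trans (*-congˡ (schur-length xs (strip-isPartition isP s)
        (ℕ.s≤s⁻¹ (ℕ.<-≤-trans l (strip-length≥ s))))) (zeroʳ _)

  schur-branching : ∀ n {N p} xs ys → IsPartition p → head₀ p ≤ N → length ys ≤ n →
    schur p (xs ++ ys) ≈
    sumList (λ ν → skewSchur p (partsOf ν) xs * schur (partsOf ν) ys) (partitionsIn n N)
  schur-branching n {N} {p} xs ys isP h l = trans (skewSchur-++ p [] xs ys)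
    (chain-expand n N (λ q → IsPartition q × head₀ q ≤ N) (λ Pq → Pq)
      (λ (isQ , hq) s → strip-isPartition isQ s , ℕ.≤-trans (strip-head₀≤ s) hq)
      (λ κ → schur κ ys) (λ (isQ , _) n< → schur-length ys isQ (ℕ.≤-<-trans l n<)) xs (isP , h))

  -- Cutting the chain after two variables reduces the claim to `skewSchur₂-comm`. The rectangle
  -- spanned by `p` contains every partition of the chain, so nothing is lost.
  skewSchur-swap : ∀ x y zs {p} q → IsPartition p →
    skewSchur p q (x ∷ y ∷ zs) ≈ skewSchur p q (y ∷ x ∷ zs)
  skewSchur-swap x y zs {p} q isP = trans (expand x y) (trans
    (sumList-cong (λ ν → *-congʳ (skewSchur₂-comm x y isP (proj₂ (parts-isPartition (partition ν))))) T)
    (sym (expand y x)))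
    where
    T = partitionsIn (length p) (head₀ p)
    expand : ∀ x y → skewSchur p q (x ∷ y ∷ zs) ≈
      sumList (λ ν → skewSchur p (partsOf ν) (x ∷ y ∷ []) * skewSchur (partsOf ν) q zs) T
    expand x y = trans (skewSchur-++ p q (x ∷ y ∷ []) zs)
      (chain-expand (length p) (head₀ p)
        (λ κ → (IsPartition κ × head₀ κ ≤ head₀ p) × length κ ≤ length p) proj₁
        (λ ((isK , hk) , lk) s → (strip-isPartition isK s , ℕ.≤-trans (strip-head₀≤ s) hk) ,
            ℕ.≤-trans (strip-length≤ s) lk)
        (λ κ → skewSchur κ q zs) (λ (_ , lk) n< → contradiction lk (ℕ.<⇒≱ n<))
        (x ∷ y ∷ []) ((isP , ℕ.≤-refl) , ℕ.≤-refl))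

  skewSchur-↭ : ∀ {xs ys p} q → IsPartition p → xs ↭ ys → skewSchur p q xs ≈ skewSchur p q ys
  skewSchur-↭ q isP ↭.refl         = refl
  skewSchur-↭ q isP (↭.prep x π)   =
    stripSum-cong x isP (λ s → skewSchur-↭ q (strip-isPartition isP s) π)
  skewSchur-↭ {xs = _ ∷ _ ∷ xs} q isP (↭.swap x y π) = trans (skewSchur-swap x y xs q isP)
    (stripSum-cong y isP (λ s → stripSum-cong x (strip-isPartition isP s)
      (λ s′ → skewSchur-↭ q (strip-isPartition (strip-isPartition isP s) s′) π)))
  skewSchur-↭ q isP (↭.trans π ρ)  = trans (skewSchur-↭ q isP π) (skewSchur-↭ q isP ρ)

  skewSchur-cong : ∀ {xs ys} p q → Pointwise _≈_ xs ys → skewSchur p q xs ≈ skewSchur p q ys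
  skewSchur-cong p q []         = refl
  skewSchur-cong p q (eq ∷ eqs) =
    sumList-cong (λ κ → *-cong (^-congˡ (ℕ.sum p ℕ.∸ ℕ.sum κ) eq) (skewSchur-cong κ q eqs))
        (removeStrip p)

-- Traces, weights and restriction to the symplectic group

module Traces {c ℓ₁ ℓ₂} (F : HeytingField c ℓ₁ ℓ₂) where
  open HeytingField F hiding (_-_; zero)
  open Characters F
  open CommutativeRing commutativeRing using (semiring; ring)
  open RingProperties ring using (-‿distribˡ-*; -‿distribʳ-*)
  open SemiringSum semiring using (sum-cong-≋; ∑-comm; *-distribˡ-sum; *-distribʳ-sum;
      sum-replicate-zero)
  open Sums F
  open import Relation.Binary.Reasoning.Setoid setoid

  sum-zero : ∀ {n} {f : Fin n → Carrier} → (∀ i → f i ≈ 0#) → sum f ≈ 0#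
  sum-zero {n} eq = trans (sum-cong-≋ eq) (sum-replicate-zero n)

  𝟙-suc : ∀ {n} (i j : Fin n) → 𝟙 (suc i) (suc j) ≈ 𝟙 i j
  𝟙-suc i j = indicator-⇔ (suc i Fin.≟ suc j) (i Fin.≟ j) Fin.suc-injective (≡.cong suc)

  sum-𝟙 : ∀ {n} (i : Fin n) (f : Fin n → Carrier) → sum (λ j → 𝟙 i j * f j) ≈ f i
  sum-𝟙 zero    f = trans (+-cong (*-identityˡ _) (sum-zero (λ j → zeroˡ (f (suc j))))) (+-identityʳ _)
  sum-𝟙 (suc i) f = trans (+-cong (zeroˡ _) (sum-cong-≋ (λ j → *-congʳ (𝟙-suc i j))))
    (trans (+-identityˡ _) (sum-𝟙 i (f ∘ suc)))

  𝟙-sym : ∀ {n} (i j : Fin n) → 𝟙 i j ≈ 𝟙 j i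
  𝟙-sym i j = indicator-⇔ (i Fin.≟ j) (j Fin.≟ i) ≡.sym ≡.sym

  diagonal-𝟙 : ∀ {n} (d : Fin n → Carrier) i j → diagonal d i j ≈ 𝟙 i j * d i
  diagonal-𝟙 d i j with i Fin.≟ j
  ... | yes _ = sym (*-identityˡ _)
  ... | no _  = sym (zeroˡ _)

  𝟙-* : ∀ {n} (d : Fin n → Carrier) i j → 𝟙 i j * d i ≈ 𝟙 i j * d j
  𝟙-* d i j with i Fin.≟ j
  ... | yes ≡.refl = refl
  ... | no _       = trans (zeroˡ _) (sym (zeroˡ _))

  diagonal-· : ∀ {m n} (d : Fin m → Carrier) (A : Matrix m n) i j → (diagonal d · A) i j ≈ d i * A i j
  diagonal-· d A i j = trans
    (sum-cong-≋ (λ k → trans (*-congʳ (diagonal-𝟙 d i k)) (*-assoc _ _ _)))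
    (sum-𝟙 i (λ k → d i * A k j))

  ·-diagonal : ∀ {m n} (A : Matrix m n) (d : Fin n → Carrier) i j → (A · diagonal d) i j ≈ A i j * d j
  ·-diagonal A d i j = trans
    (sum-cong-≋ (λ k → trans (*-congˡ (trans (diagonal-𝟙 d k j)
        (trans (𝟙-* d k j) (*-congʳ (𝟙-sym k j)))))
      (*.x∙yz≈y∙xz _ _ _)))
    (sum-𝟙 j (λ k → A i k * d j))

  diagonal-ᵀ : ∀ {n} (d : Fin n → Carrier) i j → (diagonal d ᵀ) i j ≈ diagonal d i j
  diagonal-ᵀ d i j = trans (diagonal-𝟙 d j i) (trans (𝟙-* d j i)
      (trans (*-congʳ (𝟙-sym j i)) (sym (diagonal-𝟙 d i j))))

  diagonal-inverse : ∀ {n} (d d′ : Fin n → Carrier) → (∀ i → d i * d′ i ≈ 1#) →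
      diagonal d · diagonal d′ ≈ᴹ 𝟙
  diagonal-inverse d d′ inverse i j = trans (diagonal-· d (diagonal d′) i j)
    (trans (*-congˡ (diagonal-𝟙 d′ i j)) (trans (*.x∙yz≈y∙xz _ _ _)
      (trans (*-congˡ (inverse i)) (*-identityʳ _))))

  ·-cong : ∀ {l m n} {A A′ : Matrix l m} {B B′ : Matrix m n} → A ≈ᴹ A′ → B ≈ᴹ B′ → A · B ≈ᴹ A′ · B′
  ·-cong eq eq′ i j = sum-cong-≋ (λ k → *-cong (eq i k) (eq′ k j))

  ·-assoc : ∀ {k l m n} (A : Matrix k l) (B : Matrix l m) (C : Matrix m n) → (A · B) · C ≈ᴹ A · (B · C)
  ·-assoc {l = l} A B C i j = begin
    sum (λ b → sum (λ a → A i a * B a b) * C b j)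
      ≈⟨ sum-cong-≋ (λ b → trans (*-distribʳ-sum (C b j) (λ a → A i a * B a b))
          (sum-cong-≋ {l} (λ a → *-assoc _ _ _))) ⟩
    sum (λ b → sum (λ a → A i a * (B a b * C b j)))
      ≈⟨ ∑-comm (λ b a → A i a * (B a b * C b j)) ⟩
    sum (λ a → sum (λ b → A i a * (B a b * C b j)))
      ≈⟨ sum-cong-≋ (λ a → *-distribˡ-sum (A i a) (λ b → B a b * C b j)) ⟨
    sum (λ a → A i a * sum (λ b → B a b * C b j)) ∎

  𝟙-· : ∀ {m n} (A : Matrix m n) → 𝟙 · A ≈ᴹ A
  𝟙-· A i j = sum-𝟙 i (λ k → A k j)

  ·-𝟙 : ∀ {m n} (A : Matrix m n) → A · 𝟙 ≈ᴹ A
  ·-𝟙 A i j = trans (·-diagonal A (λ _ → 1#) i j) (*-identityʳ _)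

  trace-cong : ∀ {n} {A B : Matrix n n} → A ≈ᴹ B → trace A ≈ trace B
  trace-cong eq = sum-cong-≋ (λ i → eq i i)

  trace-comm : ∀ {m n} (A : Matrix m n) (B : Matrix n m) → trace (A · B) ≈ trace (B · A)
  trace-comm {m} {n} A B = trans (∑-comm (λ i k → A i k * B k i))
    (sum-cong-≋ {n} (λ k → sum-cong-≋ {m} (λ i → *-comm _ _)))

  -- Q need not be invertible: this covers both a change of basis and a direct summand.
  trace-intertwine : ∀ {m n} (A : Matrix m m) (B : Matrix n n) (P : Matrix n m) (Q : Matrix m n) →
    P · Q ≈ᴹ 𝟙 → A · Q ≈ᴹ Q · B → trace (A · (Q · P)) ≈ trace B
  trace-intertwine A B P Q PQ AQ = begin
    trace (A · (Q · P)) ≈⟨ trace-cong (·-assoc A Q P) ⟨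
    trace ((A · Q) · P) ≈⟨ trace-cong (·-cong {B = P} AQ (λ i j → refl)) ⟩
    trace ((Q · B) · P) ≈⟨ trace-comm (Q · B) P ⟩
    trace (P · (Q · B)) ≈⟨ trace-cong (·-assoc P Q B) ⟨
    trace ((P · Q) · B) ≈⟨ trace-cong (·-cong {B = B} PQ (λ i j → refl)) ⟩
    trace (𝟙 · B)       ≈⟨ trace-cong (𝟙-· B) ⟩
    trace B             ∎

  character-weights : ∀ {G} {V : Module G} {μ} (H : HasHighestWeight V μ) z →
    character V z ≈ sum (λ k → monomial z (HasHighestWeight.weights H k))
  character-weights {G} {V} H z = begin
    trace R              ≈⟨ trace-cong (·-𝟙 R) ⟨
    trace (R · 𝟙)        ≈⟨ trace-cong (·-cong {A = R} (λ i j → refl) QP) ⟨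
    trace (R · (Q · P))  ≈⟨ trace-intertwine R D P Q PQ (diagonalise z) ⟩
    trace D              ≈⟨ sum-cong-≋ (λ k → trans (diagonal-𝟙 (λ k → monomial z (weights k)) k k)
                              (trans (*-congʳ (indicator-true (k Fin.≟ k) ≡.refl)) (*-identityˡ _))) ⟩
    sum (λ k → monomial z (weights k)) ∎
    where
    open HasHighestWeight H
    R = ρ V (torus G z)
    Q = basis
    P = proj₁ invertible
    QP = proj₁ (proj₂ invertible)
    PQ = proj₂ (proj₂ invertible)
    D = diagonal (λ k → monomial z (weights k))

  -- The identity is inserted as the sum of all `inclusion k · projection k`, and `trace-intertwine`
  -- evaluates each piece.
  decomposition-trace : ∀ {r} {L : ∀ μ → IrreducibleSp r μ} {V : Module (Sp r)} (D : Decomposition L V) →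
    ∀ g → Member (Sp r) g → trace (ρ V g) ≈ sum (λ k → trace (ρ (Decomposition.summand D k) g))
  decomposition-trace {V = V} D g g∈ = begin
    trace R
      ≈⟨ trace-cong (·-𝟙 R) ⟨
    sum (λ i → sum (λ j → R i j * 𝟙 j i))
      ≈⟨ sum-cong-≋ (λ i → sum-cong-≋ (λ j → trans (*-congˡ (sym (exhaustive j i)))
          (*-distribˡ-sum (R i j) (λ k → E k j i)))) ⟩
    sum (λ i → sum (λ j → sum (λ k → R i j * E k j i)))
      ≈⟨ sum-cong-≋ (λ i → ∑-comm (λ j k → R i j * E k j i)) ⟩
    sum (λ i → sum (λ k → sum (λ j → R i j * E k j i)))
      ≈⟨ ∑-comm (λ i k → sum (λ j → R i j * E k j i)) ⟩
    sum (λ k → trace (R · E k))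
      ≈⟨ sum-cong-≋ (λ k → trace-intertwine R (ρ (summand k) g) (projection k) (inclusion k)
          (retract k) (equivariant k g g∈)) ⟩
    sum (λ k → trace (ρ (summand k) g)) ∎
    where
    open Decomposition D
    R = ρ V g
    E : ∀ k → Matrix (dim V) (dim V)
    E k = inclusion k · projection k

  -- `J` is nonzero only where a coordinate meets its partner, and their torus entries are inverse
  -- to each other.
  z,z⁻¹-J : ∀ {r} (z : Fin r → Unit) i j →
    (val (z,z⁻¹ z i) * J r i j) * val (z,z⁻¹ z j) ≈ J r i j
  z,z⁻¹-J {r} z i j with splitAt r i | splitAt r j
  ... | inj₁ _ | inj₁ _ = trans (*-congʳ (zeroʳ _)) (zeroˡ _)
  ... | inj₂ _ | inj₂ _ = trans (*-congʳ (zeroʳ _)) (zeroˡ _)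
  ... | inj₁ k | inj₂ l = trans (*-congʳ (trans (*-comm _ _) (𝟙-* (val ∘ z) k l)))
    (trans (*-assoc _ _ _) (trans (*-congˡ (val*inv (z l))) (*-identityʳ _)))
  ... | inj₂ k | inj₁ l = trans (*-congʳ (sym (-‿distribʳ-* _ _)))
      (trans (sym (-‿distribˡ-* _ _)) (-‿cong
    (trans (*-congʳ (trans (*-comm _ _) (𝟙-* (inv ∘ z) k l)))
    (trans (*-assoc _ _ _) (trans (*-congˡ (val*inv (z l ⁻¹))) (*-identityʳ _))))))

  torus∈Sp : ∀ {r} (z : Fin r → Unit) → Member (Sp r) (torus (Sp r) z)
  torus∈Sp {r} z =
    (diagonal (inv ∘ w) , diagonal-inverse (val ∘ w) (inv ∘ w) (val*inv ∘ w)
                        , diagonal-inverse (inv ∘ w) (val ∘ w) (λ i → val*inv (w i ⁻¹)))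
    , λ i j → trans (·-diagonal (diagonal (val ∘ w) ᵀ · J r) (val ∘ w) i j) (trans (*-congʳ (trans
        (·-cong {A = diagonal (val ∘ w) ᵀ} {B = J r} (diagonal-ᵀ (val ∘ w)) (λ _ _ → refl) i j)
            (diagonal-· (val ∘ w) (J r) i j)))
        (z,z⁻¹-J z i j))
    where
    w = z,z⁻¹ z

  -- The symplectic torus at `z` is by definition the `GL` torus at `z,z⁻¹ z`, so both characters
  -- are traces of one matrix.
  schur-restriction : ∀ {r} {L : ∀ μ → IrreducibleSp r μ} {ν} (V : IrreducibleGL (r ℕ.+ r) ν)
    (D : Decomposition L (restrict (polynomialModule V))) z →
    schur (partsOf ν) (tabulate (val ∘ z,z⁻¹ z)) ≈
    sum (λ k → sp L (Vec.lookup (Decomposition.constituents D) k) z)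
  schur-restriction {r} V D z = trans (sym (IrreducibleGL.schurCharacter V (z,z⁻¹ z)))
    (decomposition-trace D (torus (Sp r) z) (torus∈Sp z))

-- The roots of unity as 1, -1 and inverse pairs

applyUpTo-++ : ∀ {a} {A : Set a} (f : ℕ → A) m n →
  applyUpTo f (m ℕ.+ n) ≡ applyUpTo f m ++ applyUpTo (f ∘ (m ℕ.+_)) n
applyUpTo-++ f zero    n = ≡.refl
applyUpTo-++ f (suc m) n = ≡.cong (f 0 ∷_) (applyUpTo-++ (f ∘ suc) m n)

applyDownFrom-applyUpTo : ∀ {a} {A : Set a} (f : ℕ → A) n →
  applyDownFrom f n ≡ applyUpTo (λ k → f (n ℕ.∸ suc k)) n
applyDownFrom-applyUpTo f zero    = ≡.refl
applyDownFrom-applyUpTo f (suc n) = ≡.cong (f n ∷_) (applyDownFrom-applyUpTo f n)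

tabulate-toℕ : ∀ {a} {A : Set a} (f : ℕ → A) n → tabulate {n = n} (f ∘ toℕ) ≡ applyUpTo f n
tabulate-toℕ f zero    = ≡.refl
tabulate-toℕ f (suc n) = ≡.cong (f 0 ∷_) (tabulate-toℕ (f ∘ suc) n)

tabulate-splitAt : ∀ {a} {A : Set a} m {n} (f : Fin m → A) (g : Fin n → A) →
  tabulate ([ f , g ] ∘ splitAt m) ≡ tabulate f ++ tabulate g
tabulate-splitAt zero    f g = ≡.refl
tabulate-splitAt (suc m) f g = ≡.cong (f zero ∷_) (≡.trans
  (List.tabulate-cong (λ i → Sum.[,]-map (splitAt m i)))
  (tabulate-splitAt m (f ∘ suc) g))

-- The exponents of ξ in the list 1, -1, ξ, …, ξᵐ, ξ⁻¹, …, ξ⁻ᵐ, for t = 2m + 2.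
exponent : ∀ m → Fin (m ℕ.+ m) → ℕ
exponent m i = [ suc ∘ toℕ , (λ k → suc m ℕ.+ suc (m ℕ.∸ suc (toℕ k))) ] (splitAt m i)

-- The inverse powers have exponents 2m + 1 down to m + 2, hence the reversal; `suc m`, the exponent
-- of -1, moves between the two blocks.
exponents-↭ : ∀ m → 0 ∷ suc m ∷ tabulate (exponent m) ↭ upTo (suc m ℕ.+ suc m)
exponents-↭ m = ↭.prep 0 (begin
  suc m ∷ tabulate (exponent m)
    ≡⟨ ≡.cong (suc m ∷_) (tabulate-splitAt m (suc ∘ toℕ) _) ⟩
  suc m ∷ tabulate {n = m} (suc ∘ toℕ) ++ tabulate {n = m} (λ k → f (m ℕ.∸ suc (toℕ k)))
    ≡⟨ ≡.cong₂ (λ xs ys → suc m ∷ xs ++ ys) (tabulate-toℕ suc m)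
         (≡.trans (tabulate-toℕ _ m) (≡.trans (≡.sym (applyDownFrom-applyUpTo f m))
             (≡.sym (List.reverse-applyUpTo f m)))) ⟩
  suc m ∷ applyUpTo suc m ++ reverse (applyUpTo f m)
    ↭⟨ ↭.prep (suc m) (↭.++⁺ˡ (applyUpTo suc m) (↭.↭-reverse (applyUpTo f m))) ⟩
  suc m ∷ applyUpTo suc m ++ applyUpTo f m
    ↭⟨ ↭.shift (suc m) (applyUpTo suc m) _ ⟨
  applyUpTo suc m ++ suc m ∷ applyUpTo f m
    ≡⟨ ≡.cong (λ k → applyUpTo suc m ++ suc k ∷ applyUpTo f m) (ℕ.+-identityʳ m) ⟨
  applyUpTo suc m ++ applyUpTo (λ k → suc (m ℕ.+ k)) (suc m)
    ≡⟨ applyUpTo-++ suc m (suc m) ⟨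
  applyUpTo suc (m ℕ.+ suc m) ∎)
  where
  open ↭.PermutationReasoning
  f : ℕ → ℕ
  f k = suc m ℕ.+ suc k

module RootsOfUnity {c ℓ₁ ℓ₂} (F : HeytingField c ℓ₁ ℓ₂) where
  open HeytingField F hiding (zero)
  open Characters F
  open CommutativeRing commutativeRing using (ring)
  open RingProperties ring using (-‿distribˡ-*; +-inverseˡ-unique)
  open Exp commutativeSemiring using (^-homo-*; ^-congʳ)
  open Sums F
  open SchurFunctions F
  open import Relation.Binary.Reasoning.Setoid setoid

  val-^ᵘ : ∀ u n → val (u ^ᵘ n) ≡ val u ^ n
  val-^ᵘ u zero    = ≡.refl
  val-^ᵘ u (suc n) = ≡.cong (val u *_) (val-^ᵘ u n)

  inv-unique : ∀ u {b} → val u * b ≈ 1# → inv u ≈ b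
  inv-unique u {b} ub = begin
    inv u               ≈⟨ *-identityʳ _ ⟨
    inv u * 1#          ≈⟨ *-congˡ ub ⟨
    inv u * (val u * b) ≈⟨ *-assoc _ _ _ ⟨
    (inv u * val u) * b ≈⟨ *-congʳ (val*inv (u ⁻¹)) ⟩
    1# * b              ≈⟨ *-identityˡ b ⟩
    b                   ∎

  #⇒*-cancel : ∀ {a b x} → a # b → x * (a - b) ≈ 0# → x ≈ 0#
  #⇒*-cancel {a} {b} {x} a#b eq with #⇒invertible a#b
  ... | v , _ , right = begin
    x                  ≈⟨ *-identityʳ x ⟨
    x * 1#             ≈⟨ *-congˡ right ⟨
    x * ((a - b) * v)  ≈⟨ *-assoc _ _ _ ⟨
    (x * (a - b)) * v  ≈⟨ *-congʳ eq ⟩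
    0# * v             ≈⟨ zeroˡ v ⟩
    0#                 ∎

  -- In w² - 1 = (w + 1)(w - 1) the second factor is invertible, being a difference of elements that
  -- are apart.
  square≈1⇒≈-1 : ∀ {w} → w # 1# → w * w ≈ 1# → w ≈ - 1#
  square≈1⇒≈-1 {w} w#1 ww = +-inverseˡ-unique w 1# (#⇒*-cancel w#1 (begin
    (w + 1#) * (w - 1#)                ≈⟨ distribʳ _ _ _ ⟩
    w * (w - 1#) + 1# * (w - 1#)       ≈⟨ +-cong (trans (distribˡ _ _ _) (+-cong ww
                                            (trans (*-comm _ _) (trans (sym (-‿distribˡ-* _ _))
                                                (-‿cong (*-identityˡ w))))))
                                            (*-identityˡ _) ⟩
    (1# + - w) + (w + - 1#)            ≈⟨ +-assoc _ _ _ ⟩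
    1# + (- w + (w + - 1#))            ≈⟨ +-congˡ
        (trans (sym (+-assoc _ _ _)) (trans (+-congʳ (-‿inverseˡ w)) (+-identityˡ _))) ⟩
    1# + - 1#                          ≈⟨ -‿inverseʳ 1# ⟩
    0#                                 ∎))

  module _ {m} (ζ : PrimitiveRoot (suc m ℕ.+ suc m)) where
    private
      x = val (ξ ζ)
      y : Fin m → Unit
      y i = ξ ζ ^ᵘ suc (toℕ i)

    -- The square of `x ^ suc m` is `x ^ t`, and primitivity keeps `x ^ suc m` itself apart from 1.
    half-power : - 1# ≈ x ^ suc m
    half-power = sym (square≈1⇒≈-1
      (order ζ (suc m) (s≤s z≤n) (ℕ.m<m+n (suc m) (s≤s z≤n)))
      (trans (sym (^-homo-* x (suc m) (suc m))) (root ζ)))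

    power-exponent : ∀ i → val (z,z⁻¹ y i) ≈ x ^ exponent m i
    power-exponent i with splitAt m i
    ... | inj₁ k = reflexive (val-^ᵘ (ξ ζ) (suc (toℕ k)))
    ... | inj₂ k = inv-unique (y k) (begin
      val (y k) * x ^ l                  ≡⟨ ≡.cong (_* x ^ l) (val-^ᵘ (ξ ζ) (suc (toℕ k))) ⟩
      x ^ suc (toℕ k) * x ^ l            ≈⟨ ^-homo-* x (suc (toℕ k)) l ⟨
      x ^ (suc (toℕ k) ℕ.+ l)            ≈⟨ ^-congʳ x total ⟩
      x ^ (suc m ℕ.+ suc m)              ≈⟨ root ζ ⟩
      1#                                 ∎)
      where
      l = suc m ℕ.+ suc (m ℕ.∸ suc (toℕ k))
      -- The inverse of the power k of ξ is its power t - k.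
      total : suc (toℕ k) ℕ.+ l ≡ suc m ℕ.+ suc m
      total = ≡.trans (≡.trans (≡.sym (ℕ.+-assoc (suc (toℕ k)) (suc m) _))
        (≡.trans (≡.cong (ℕ._+ suc (m ℕ.∸ suc (toℕ k))) (ℕ.+-comm (suc (toℕ k)) (suc m)))
          (ℕ.+-assoc (suc m) (suc (toℕ k)) _)))
        (≡.cong (suc m ℕ.+_) (≡.trans (ℕ.+-suc (suc (toℕ k)) _)
            (≡.cong suc (ℕ.m+[n∸m]≡n (Fin.toℕ<n k)))))

    schur-rootsOfUnity : ∀ {p} → IsPartition p → ∀ ws →
      schur p (1# ∷ - 1# ∷ tabulate (val ∘ z,z⁻¹ y) ++ ws) ≈ schur p (rootsOfUnity ζ ++ ws)
    schur-rootsOfUnity {p} isP ws = begin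
      schur p (1# ∷ - 1# ∷ tabulate (val ∘ z,z⁻¹ y) ++ ws)
        ≈⟨ skewSchur-cong p [] (refl ∷ half-power ∷
             Pointwise.++⁺ (≡.subst (Pointwise _≈_ _)
                 (≡.sym (List.map-tabulate (exponent m) (x ^_))) (Pointwise.tabulate⁺ power-exponent))
               (Pointwise.refl refl)) ⟩
      schur p (map (x ^_) (0 ∷ suc m ∷ tabulate (exponent m)) ++ ws)
        ≈⟨ skewSchur-↭ [] isP (↭.++⁺ʳ ws (↭.map⁺ (x ^_) (exponents-↭ m))) ⟩
      schur p (map (x ^_) (upTo (suc m ℕ.+ suc m)) ++ ws)
        ≡⟨ ≡.cong (λ xs → schur p (xs ++ ws)) (List.map-upTo (x ^_) (suc m ℕ.+ suc m)) ⟩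
      schur p (rootsOfUnity ζ ++ ws) ∎

-- Heights and dominance of weights

-- A linear functional positive on all positive roots.
height : ∀ {n} → Weight n → ℤ
height []                = + 0
height {suc n} (x ∷ xs)  = + suc n ℤ.* x ℤ.+ height xs

height-⊕ : ∀ {n} (v w : Weight n) → height (v ⊕ w) ≡ height v ℤ.+ height w
height-⊕ []                []       = ≡.refl
height-⊕ {suc n} (x ∷ v) (y ∷ w) = ≡.trans (≡.cong (λ s → + suc n ℤ.* (x ℤ.+ y) ℤ.+ s) (height-⊕ v w))
  (lemma (+ suc n) x y (height v) (height w))
  where
  lemma : ∀ a x y s t → a ℤ.* (x ℤ.+ y) ℤ.+ (s ℤ.+ t) ≡ (a ℤ.* x ℤ.+ s) ℤ.+ (a ℤ.* y ℤ.+ t)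
  lemma = ℤSolver.solve-∀

height-⊖ : ∀ {n} (v w : Weight n) → height (v ⊖ w) ≡ height v ℤ.- height w
height-⊖ []                []       = ≡.refl
height-⊖ {suc n} (x ∷ v) (y ∷ w) = ≡.trans (≡.cong (λ s → + suc n ℤ.* (x ℤ.- y) ℤ.+ s) (height-⊖ v w))
  (lemma (+ suc n) x y (height v) (height w))
  where
  lemma : ∀ a x y s t → a ℤ.* (x ℤ.- y) ℤ.+ (s ℤ.- t) ≡ (a ℤ.* x ℤ.+ s) ℤ.- (a ℤ.* y ℤ.+ t)
  lemma = ℤSolver.solve-∀

height-0 : ∀ n → height (Vec.replicate n (+ 0)) ≡ + 0
height-0 zero    = ≡.refl
height-0 (suc n) = ≡.cong₂ ℤ._+_ (ℤ.*-zeroʳ (+ suc n)) (height-0 n)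

height-e : ∀ {n} (i : Fin n) → height (e i) ≡ + (n ℕ.∸ toℕ i)
height-e {suc n} zero    = ≡.trans (≡.cong₂ ℤ._+_ (ℤ.*-identityʳ (+ suc n)) (height-0 n))
    (ℤ.+-identityʳ _)
height-e {suc n} (suc i) = ≡.trans (≡.cong₂ ℤ._+_ (ℤ.*-zeroʳ (+ suc n)) (height-e i)) (ℤ.+-identityˡ _)

-- The coordinates are weighted by n, ..., 2, 1, the half-sum of the positive roots of type C:
-- strict decrease handles `e i ⊖ e j`, positivity handles `e i ⊕ e j`.
height-positiveRoot : ∀ {n} {α : Weight n} → PositiveRootC α → + 0 ℤ.< height α
height-positiveRoot {n} (e-e {i} {j} i<j) = ≡.subst (+ 0 ℤ.<_)
  (≡.sym (≡.trans (height-⊖ (e i) (e j)) (≡.cong₂ ℤ._-_ (height-e i) (height-e j))))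
  (≡.subst (ℤ._< + (n ℕ.∸ toℕ i) ℤ.- + (n ℕ.∸ toℕ j)) (ℤ.+-inverseʳ (+ (n ℕ.∸ toℕ j)))
    (ℤ.+-monoˡ-< (ℤ.- + (n ℕ.∸ toℕ j)) (ℤ.+<+ (ℕ.∸-monoʳ-< i<j (ℕ.<⇒≤ (Fin.toℕ<n j))))))
height-positiveRoot {n} (e+e {i} {j} _) = ≡.subst (+ 0 ℤ.<_)
  (≡.sym (≡.trans (height-⊕ (e i) (e j)) (≡.cong₂ ℤ._+_ (height-e i) (height-e j))))
  (ℤ.+<+ (ℕ.<-≤-trans (ℕ.m<n⇒0<n∸m (Fin.toℕ<n i)) (ℕ.m≤m+n _ _)))

height-dominated : ∀ {n} {μ w : Weight n} → Star (λ v w → ∃[ α ] PositiveRootC α × v ≡ w ⊕ α) μ w →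
  μ ≡ w ⊎ height w ℤ.< height μ
height-dominated Star.ε = inj₁ ≡.refl
height-dominated (_◅_ {j = v} (α , α∈ , ≡.refl) ss) =
  inj₂ ([ (λ { ≡.refl → below }) , (λ w<v → ℤ.<-trans w<v below) ] (height-dominated ss))
  where
  below : height v ℤ.< height (v ⊕ α)
  below = ≡.subst₂ ℤ._<_ (ℤ.+-identityʳ (height v)) (≡.sym (height-⊕ v α))
    (ℤ.+-monoʳ-< (height v) (height-positiveRoot α∈))

-- Zero parts are excluded, so padding with zeros up to `n` coordinates loses nothing.
part-injective : ∀ n {p q} → Positive p → Positive q → length p ≤ n → length q ≤ n →
  (∀ (i : Fin n) → part p (toℕ i) ≡ part q (toℕ i)) → p ≡ q
part-injective n       {[]}    {[]}    _ _ _ _ eq = ≡.refl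
part-injective (suc n) {[]}    {_ ∷ _} _ (0<b ∷ _) _ _ eq = contradiction (eq zero) (ℕ.<⇒≢ 0<b)
part-injective (suc n) {_ ∷ _} {[]}    (0<a ∷ _) _ _ _ eq = contradiction (≡.sym (eq zero)) (ℕ.<⇒≢ 0<a)
part-injective (suc n) {_ ∷ _} {_ ∷ _} (_ ∷ pp) (_ ∷ pq) (s≤s lp) (s≤s lq) eq =
  ≡.cong₂ _∷_ (eq zero) (part-injective n pp pq lp lq (eq ∘ suc))

partitionWeight-injective : ∀ {n} {κ μ : PartitionAtMost n} → partitionWeight κ ≡ partitionWeight μ
    → κ ≡ μ
partitionWeight-injective {n} {κ} {μ} eq = from (part-injective n
  (proj₂ (parts-isPartition (partition κ))) (proj₂ (parts-isPartition (partition μ)))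
  (partsOf-length≤ κ) (partsOf-length≤ μ)
  (λ i → ℤ.+-injective (≡.trans (≡.sym (Vec.lookup∘tabulate _ i))
    (≡.trans (≡.cong (λ w → Vec.lookup w i) eq) (Vec.lookup∘tabulate _ i)))))
  where
  from : partsOf κ ≡ partsOf μ → κ ≡ μ
  from ≡.refl = ≡.refl

positivePart negativePart : ℤ → ℕ
positivePart (+ n)    = n
positivePart -[1+ n ] = 0
negativePart (+ n)    = 0
negativePart -[1+ n ] = suc n

-- The hypothesis is p = q with the negative parts moved across, the form it takes once negative
-- powers are cleared.
parts-injective : ∀ p q → positivePart p ℕ.+ negativePart q ≡ positivePart q ℕ.+ negativePart p → p ≡ q
parts-injective (+ m)    (+ n)    eq =
  ≡.cong +_ (≡.trans (≡.sym (ℕ.+-identityʳ m)) (≡.trans eq (ℕ.+-identityʳ n)))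
parts-injective (+ m)    -[1+ n ] eq = contradiction (≡.trans (≡.sym (ℕ.+-suc m n)) eq) λ ()
parts-injective -[1+ m ] (+ n)    eq = contradiction (≡.trans eq (ℕ.+-suc n m)) λ ()
parts-injective -[1+ m ] -[1+ n ] eq = ≡.cong -[1+_] (≡.sym (ℕ.suc-injective eq))

-- Linear independence of torus monomials

module Independence {c ℓ₁ ℓ₂} (F : HeytingField c ℓ₁ ℓ₂) where
  open HeytingField F hiding (zero)
  open Characters F
  open CommutativeRing commutativeRing using (ring; semiring; *-commutativeMonoid)
  open RingProperties ring using (-0#≈0#; -‿distribʳ-*; +-identityʳ-unique; x∙y⁻¹≈ε⇒x≈y)
  open CommutativeMonoidSum *-commutativeMonoid using ()
    renaming (∑-distrib-+ to product-*; sum-cong-≋ to product-cong; sum-replicate-zero to product-1)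
  open SemiringMult semiring using (×1-homo-*)
  open Exp commutativeSemiring using (^-homo-*; ^-congʳ; ^-congˡ; ^-distrib-*)
  open Sums F
  open Traces F
  open RootsOfUnity F using (#⇒*-cancel)
  open import Relation.Binary.Reasoning.Setoid setoid

  1^ : ∀ n → 1# ^ n ≈ 1#
  1^ zero    = refl
  1^ (suc n) = trans (*-identityˡ _) (1^ n)

  1^ᶻ : ∀ n → 1ᵘ ^ᶻ n ≈ 1#
  1^ᶻ (+ n)    = 1^ n
  1^ᶻ -[1+ n ] = 1^ (suc n)

  *ᵘ-^ᶻ : ∀ u v n → (u *ᵘ v) ^ᶻ n ≈ u ^ᶻ n * v ^ᶻ n
  *ᵘ-^ᶻ u v (+ n)    = ^-distrib-* (val u) (val v) n
  *ᵘ-^ᶻ u v -[1+ n ] = trans (^-distrib-* (inv v) (inv u) (suc n)) (*-comm _ _)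

  monomial-* : ∀ {n} (a z : Fin n → Unit) w →
    monomial (λ i → a i *ᵘ z i) w ≈ monomial a w * monomial z w
  monomial-* {n} a z w = trans (product-cong {n} (λ i → *ᵘ-^ᶻ (a i) (z i) (Vec.lookup w i)))
    (product-* (λ i → a i ^ᶻ Vec.lookup w i) (λ i → z i ^ᶻ Vec.lookup w i))

  monomial-1 : ∀ {n} (w : Weight n) → monomial (λ _ → 1ᵘ) w ≈ 1#
  monomial-1 {n} w = trans (product-cong {n} (λ i → 1^ᶻ (Vec.lookup w i))) (product-1 n)

  cocharacter : ∀ {n} → Unit → Fin n → Fin n → Unit
  cocharacter u zero    zero    = u
  cocharacter u zero    (suc _) = 1ᵘ
  cocharacter u (suc _) zero    = 1ᵘ
  cocharacter u (suc i) (suc j) = cocharacter u i j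

  monomial-cocharacter : ∀ {n} u i (w : Weight n) → monomial (cocharacter u i) w ≈ u ^ᶻ Vec.lookup w i
  monomial-cocharacter u zero    (x ∷ w) = trans (*-congˡ (monomial-1 w)) (*-identityʳ _)
  monomial-cocharacter u (suc i) (x ∷ w) =
    trans (*-cong (1^ᶻ x) (monomial-cocharacter u i w)) (*-identityˡ _)

  ^ᶻ-parts : ∀ u p → u ^ᶻ p * val u ^ negativePart p ≈ val u ^ positivePart p
  ^ᶻ-parts u (+ n)    = *-identityʳ _
  ^ᶻ-parts u -[1+ n ] = trans (sym (^-distrib-* (inv u) (val u) (suc n)))
    (trans (^-congˡ (suc n) (val*inv (u ⁻¹))) (1^ (suc n)))

  #0⇒*-cancel : ∀ {a x} → a # 0# → x * a ≈ 0# → x ≈ 0#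
  #0⇒*-cancel a#0 eq = #⇒*-cancel a#0
    (trans (*-congˡ (trans (+-congˡ -0#≈0#) (+-identityʳ _))) eq)

  module _ (char0 : CharacteristicZero) where

    -- A unit whose distinct powers differ by invertible elements; the whole field need not supply
    -- more to separate characters.
    two : Unit
    two with #⇒invertible (char0 1)
    ... | h , left , right = mkUnit (2 ·ℕ 1#) h
      (trans (*-congʳ (sym (trans (+-congˡ -0#≈0#) (+-identityʳ _)))) right)

    two-^ : ∀ n → ∃[ k ] val two ^ n ≈ suc k ·ℕ 1#
    two-^ zero    = 0 , sym (+-identityʳ 1#)
    two-^ (suc n) with two-^ n
    ... | k , eq = k ℕ.+ suc (k ℕ.+ 0) , trans (*-congˡ eq) (sym (×1-homo-* 2 (suc k)))

    -- From 2^n = k + 1 follows 2^(n+1) = 1 + (2k + 1), which exhibits 2^(n+1) - 1 as a positive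
    -- integer.
    two-^-suc : ∀ n → ∃[ k ] val two ^ suc n ≈ 1# + suc k ·ℕ 1#
    two-^-suc n with two-^ n
    ... | k , eq = k ℕ.+ (k ℕ.+ 0) , trans (*-congˡ eq) (trans (sym (×1-homo-* 2 (suc k)))
      (reflexive (≡.cong (λ j → suc j ·ℕ 1#) (ℕ.+-suc k (k ℕ.+ 0)))))

    -- Writing 2^n as 2^m (1 + j) with `j` a positive integer gives x 2^m j = 0, and both `j` and
    -- 2^m can be cancelled.
    two-^-cancel< : ∀ m n {x} → m < n → x * val two ^ m ≈ x * val two ^ n → x ≈ 0#
    two-^-cancel< m n {x} m<n eq with two-^-suc (n ℕ.∸ suc m) | two-^ m
    ... | k , eqₖ | l , eqₗ = #0⇒*-cancel (char0 l) (trans (*-congˡ (sym eqₗ))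
      (#0⇒*-cancel (char0 k) (+-identityʳ-unique _ _ (begin
        x * val two ^ m + (x * val two ^ m) * (suc k ·ℕ 1#)
          ≈⟨ +-congʳ (*-identityʳ _) ⟨
        (x * val two ^ m) * 1# + (x * val two ^ m) * (suc k ·ℕ 1#)
          ≈⟨ distribˡ _ _ _ ⟨
        (x * val two ^ m) * (1# + suc k ·ℕ 1#)
          ≈⟨ *-congˡ eqₖ ⟨
        (x * val two ^ m) * val two ^ suc (n ℕ.∸ suc m)
          ≈⟨ trans (*-assoc _ _ _) (*-congˡ (sym (^-homo-* (val two) m (suc (n ℕ.∸ suc m))))) ⟩
        x * val two ^ (m ℕ.+ suc (n ℕ.∸ suc m))
          ≈⟨ *-congˡ (^-congʳ (val two) (≡.trans (ℕ.+-suc m _) (ℕ.m+[n∸m]≡n m<n))) ⟩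
        x * val two ^ n
          ≈⟨ eq ⟨
        x * val two ^ m ∎))))

    two-^-cancel : ∀ m n {x} → m ≢ n → x * val two ^ m ≈ x * val two ^ n → x ≈ 0#
    two-^-cancel m n m≢n eq with ℕ.<-cmp m n
    ... | tri< m<n _ _ = two-^-cancel< m n m<n eq
    ... | tri≈ _ m≡n _ = contradiction m≡n m≢n
    ... | tri> _ _ n<m = two-^-cancel< n m n<m (sym eq)

    two-^ᶻ-cancel : ∀ p q {x} → p ≢ q → x * two ^ᶻ p ≈ x * two ^ᶻ q → x ≈ 0#
    two-^ᶻ-cancel p q {x} p≢q eq = two-^-cancel _ _ (p≢q ∘ parts-injective p q) (begin
      x * 2^ (positivePart p ℕ.+ negativePart q)
        ≈⟨ *-congˡ (^-homo-* (val two) (positivePart p) (negativePart q)) ⟩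
      x * (2^ positivePart p * 2^ negativePart q)
        ≈⟨ *-congˡ (*-congʳ (^ᶻ-parts two p)) ⟨
      x * ((two ^ᶻ p * 2^ negativePart p) * 2^ negativePart q)
        ≈⟨ trans (*-congˡ (*-assoc _ _ _)) (sym (*-assoc _ _ _)) ⟩
      (x * two ^ᶻ p) * (2^ negativePart p * 2^ negativePart q)
        ≈⟨ *-cong eq (*-comm _ _) ⟩
      (x * two ^ᶻ q) * (2^ negativePart q * 2^ negativePart p)
        ≈⟨ trans (*-congˡ (*-assoc _ _ _)) (sym (*-assoc _ _ _)) ⟨
      x * ((two ^ᶻ q * 2^ negativePart q) * 2^ negativePart p)
        ≈⟨ *-congˡ (*-congʳ (^ᶻ-parts two q)) ⟩
      x * (2^ positivePart q * 2^ negativePart p)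
        ≈⟨ *-congˡ (^-homo-* (val two) (positivePart q) (negativePart p)) ⟨
      x * 2^ (positivePart q ℕ.+ negativePart p) ∎)
      where
      infix 9 2^_
      2^_ : ℕ → Carrier
      2^ n = val two ^ n

    separate : ∀ {n} (v w : Weight n) → v ≢ w → ∃[ i ] Vec.lookup v i ≢ Vec.lookup w i
    separate []      []      v≢w = contradiction ≡.refl v≢w
    separate (x ∷ v) (y ∷ w) v≢w with x ℤ.≟ y
    ... | no x≢y     = zero , x≢y
    ... | yes ≡.refl with separate v w (v≢w ∘ ≡.cong (x ∷_))
    ...   | i , neq = suc i , neq

    -- Dedekind's argument: subtracting χ_v(a) times the relation at z from the relation at a z
    -- eliminates χ_v, and a can be chosen to keep any other given character.
    monomials-independent-unique : ∀ {n} (f : Weight n → Carrier) {ws} → Unique ws →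
      (∀ z → sumList (λ w → f w * monomial z w) ws ≈ 0#) → ∀ {w} → w ∈ ws → f w ≈ 0#
    monomials-independent-unique {n} f {v ∷ ws} (v# ∷ u) rel = cases
      where
      χ = monomial

      shifted : ∀ a z → sumList (λ w → (f w * (χ a w - χ a v)) * χ z w) ws ≈ 0#
      shifted a z = begin
        sumList (λ w → (f w * (χ a w - χ a v)) * χ z w) ws
          ≈⟨ +-identityˡ _ ⟨
        -- The term at `v` has coefficient `χ a v - χ a v`, so it can be restored at no cost and
        -- `rel` becomes applicable.
        0# + sumList (λ w → (f w * (χ a w - χ a v)) * χ z w) ws
          ≈⟨ +-congʳ (trans (*-congʳ (trans (*-congˡ (-‿inverseʳ (χ a v))) (zeroʳ _))) (zeroˡ _)) ⟨
        sumList (λ w → (f w * (χ a w - χ a v)) * χ z w) (v ∷ ws)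
          ≈⟨ sumList-cong (λ w → term w) (v ∷ ws) ⟩
        sumList (λ w → f w * χ (λ i → a i *ᵘ z i) w + - χ a v * (f w * χ z w)) (v ∷ ws)
          ≈⟨ sumList-+ _ _ (v ∷ ws) ⟩
        sumList (λ w → f w * χ (λ i → a i *ᵘ z i) w) (v ∷ ws)
            + sumList (λ w → - χ a v * (f w * χ z w)) (v ∷ ws)
          ≈⟨ +-cong (rel _) (trans (sym (*-sumList (- χ a v) (λ w → f w * χ z w) (v ∷ ws)))
               (trans (*-congˡ (rel z)) (zeroʳ _))) ⟩
        0# + 0#
          ≈⟨ +-identityˡ 0# ⟩
        0# ∎
        where
        term : ∀ w → (f w * (χ a w - χ a v)) * χ z w ≈
                     f w * χ (λ i → a i *ᵘ z i) w + - χ a v * (f w * χ z w)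
        term w = begin
          (f w * (χ a w + - χ a v)) * χ z w
            ≈⟨ *-congʳ (distribˡ _ _ _) ⟩
          (f w * χ a w + f w * - χ a v) * χ z w
            ≈⟨ distribʳ _ _ _ ⟩
          (f w * χ a w) * χ z w + (f w * - χ a v) * χ z w
            ≈⟨ +-cong (trans (*-assoc _ _ _) (*-congˡ (sym (monomial-* a z w))))
                 (trans (*-congʳ (*-comm _ _)) (*-assoc _ _ _)) ⟩
          f w * χ (λ i → a i *ᵘ z i) w + - χ a v * (f w * χ z w) ∎

      others : ∀ {w} → w ∈ ws → f w ≈ 0#
      -- At a coordinate where `w` and `v` differ, the cocharacter of 2 takes distinct powers of 2
      -- on the two weights.
      others {w} w∈ with separate w v (λ { ≡.refl → All.lookup v# w∈ ≡.refl })
      ... | i , neq = two-^ᶻ-cancel (Vec.lookup w i) (Vec.lookup v i) neq (begin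
        f w * two ^ᶻ Vec.lookup w i  ≈⟨ *-congˡ (monomial-cocharacter two i w) ⟨
        f w * χ a w                  ≈⟨ x∙y⁻¹≈ε⇒x≈y _ _ (trans (sym (trans (distribˡ _ _ _)
                                          (+-congˡ (sym (-‿distribʳ-* _ _)))))
                                          (monomials-independent-unique
                                              (λ w → f w * (χ a w - χ a v)) u (shifted a) w∈)) ⟩
        f w * χ a v                  ≈⟨ *-congˡ (monomial-cocharacter two i v) ⟩
        f w * two ^ᶻ Vec.lookup v i  ∎)
        where
        a = cocharacter two i

      cases : ∀ {w} → w ∈ v ∷ ws → f w ≈ 0#
      cases (there w∈)     = others w∈
      -- With the other coefficients gone, the relation at the identity of the torus leaves `f v`.
      cases (here ≡.refl) = begin
        f v
            ≈⟨ trans (*-congˡ (monomial-1 v)) (*-identityʳ _) ⟨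
        f v * χ 1s v                                    ≈⟨ +-identityʳ _ ⟨
        f v * χ 1s v + 0#
            ≈⟨ +-congˡ (sumList-zero ws (λ w∈ → trans (*-congʳ (others w∈)) (zeroˡ _))) ⟨
        sumList (λ w → f w * χ 1s w) (v ∷ ws)           ≈⟨ rel 1s ⟩
        0#                                              ∎
        where
        1s : Fin n → Unit
        1s _ = 1ᵘ

-- Linear independence of symplectic characters

infix 4 _≟ʷ_

_≟ʷ_ : ∀ {n} → DecidableEquality (Weight n)
_≟ʷ_ = Vec.≡-dec ℤ._≟_

i≤∣i∣ : ∀ i → i ℤ.≤ + ℤ.∣ i ∣
i≤∣i∣ (+ n)    = ℤ.≤-refl
i≤∣i∣ -[1+ n ] = ℤ.-≤+

upperBound : ∀ {a} {A : Set a} (f : A → ℤ) xs → ∃[ H ] (∀ {x} → x ∈ xs → f x ℤ.< H)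
upperBound f []       = + 0 , λ ()
upperBound f (x ∷ xs) with upperBound f xs
... | H , bd = ℤ.suc (f x) ℤ.⊔ H , λ
  { (here ≡.refl) → ℤ.<-≤-trans (ℤ.suc[i]≤j⇒i<j ℤ.≤-refl) (ℤ.i≤i⊔j _ H)
  ; (there y∈)    → ℤ.<-≤-trans (bd y∈) (ℤ.i≤j⊔i _ H) }

module Combinations {c ℓ₁ ℓ₂} (F : HeytingField c ℓ₁ ℓ₂) where
  open HeytingField F hiding (zero)
  open Characters F
  open Sums F
  open Traces F
  open Independence F
  open import Relation.Binary.Reasoning.Setoid setoid

  -- Formal linear combinations are lists in which an index may recur, so that concatenation is
  -- addition; `coeffOf` gathers the repeated entries.
  combine : ∀ {a} {I : Set a} → (I → Carrier) → List (Carrier × I) → Carrier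
  combine g = sumList (λ (x , i) → x * g i)

  module _ {a} {I : Set a} (_≟_ : DecidableEquality I) where

    coeffOf : List (Carrier × I) → I → Carrier
    coeffOf cs i = combine (λ j → indicator (j ≟ i)) cs

    -- `i` is added even if `cs` lacks it, so that a coefficient can be read off at any index.
    index : I → List (Carrier × I) → List I
    index i cs = deduplicate _≟_ (i ∷ map proj₂ cs)

    ∈-index : ∀ i cs → i ∈ index i cs
    ∈-index i cs = ∈-deduplicate⁺ _≟_ {xs = i ∷ map proj₂ cs} (here ≡.refl)

    index-unique : ∀ i cs → Unique (index i cs)
    index-unique i cs = Unique.deduplicate-! _≟_ (i ∷ map proj₂ cs)

    combine-collect : ∀ (g : I → Carrier) i cs →
      combine g cs ≈ sumList (λ j → coeffOf cs j * g j) (index i cs)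
    combine-collect g i cs = begin
      combine g cs
        ≈⟨ sumList-cong-∈ cs (λ {(x , j)} ∈cs → *-congˡ (sym (sumList-indicator _≟_ g (index-unique i cs)
             (∈-deduplicate⁺ _≟_ (there (∈-map⁺ proj₂ ∈cs)))))) ⟩
      sumList (λ (x , j) → x * sumList (λ k → indicator (j ≟ k) * g k) T) cs
        ≈⟨ sumList-cong (λ (x , j) → trans (*-sumList x _ T)
            (sumList-cong (λ k → sym (*-assoc _ _ _)) T)) cs ⟩
      sumList (λ (x , j) → sumList (λ k → (x * indicator (j ≟ k)) * g k) T) cs
        ≈⟨ sumList-comm (λ (x , j) k → (x * indicator (j ≟ k)) * g k) cs T ⟩
      sumList (λ k → sumList (λ (x , j) → (x * indicator (j ≟ k)) * g k) cs) T
        ≈⟨ sumList-cong (λ k → sumList-* (g k) (λ (x , j) → x * indicator (j ≟ k)) cs) T ⟨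
      sumList (λ k → coeffOf cs k * g k) T ∎
      where
      T = index i cs

  sumList-tabulate : ∀ {a} {A : Set a} {n} (f : A → Carrier) (g : Fin n → A) →
    sumList f (tabulate g) ≈ sum (f ∘ g)
  sumList-tabulate {n = zero}  f g = refl
  sumList-tabulate {n = suc n} f g = +-congˡ (sumList-tabulate f (g ∘ suc))

  *-sum : ∀ {n} x (f : Fin n → Carrier) → x * sum f ≈ sum (λ k → x * f k)
  *-sum {zero}  x f = zeroʳ x
  *-sum {suc n} x f = trans (distribˡ x _ _) (+-congˡ (*-sum x (f ∘ suc)))

  sum-indicator : ∀ {p n} {P : Fin n → Set p} (P? : ∀ k → Dec (P k)) →
    ∃[ j ] sum (λ k → indicator (P? k)) ≈ j ·ℕ 1#
  sum-indicator {n = zero}  P? = 0 , refl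
  sum-indicator {n = suc n} P? with sum-indicator (P? ∘ suc) | P? zero
  ... | j , eqⱼ | yes _ = suc j , +-cong refl eqⱼ
  ... | j , eqⱼ | no _  = j , trans (+-cong refl eqⱼ) (+-identityˡ _)

  -- The explicit `suc j` is the form to which `CharacteristicZero` applies.
  sum-indicator-positive : ∀ {p n} {P : Fin n → Set p} (P? : ∀ k → Dec (P k)) → ∃[ k ] P k →
    ∃[ j ] sum (λ k → indicator (P? k)) ≈ suc j ·ℕ 1#
  sum-indicator-positive P? (zero , p) with sum-indicator (P? ∘ suc)
  ... | j , eq = j , +-cong (indicator-true (P? zero) p) eq
  sum-indicator-positive P? (suc k , p) with sum-indicator-positive (P? ∘ suc) (k , p) | P? zero
  ... | j , eqⱼ | yes _ = suc j , +-cong refl eqⱼ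
  ... | j , eqⱼ | no _  = j , trans (+-cong refl eqⱼ) (+-identityˡ _)

  module _ (char0 : CharacteristicZero) where

    monomials-independent : ∀ {n} (cs : List (Carrier × Weight n)) →
      (∀ z → combine (monomial z) cs ≈ 0#) → ∀ w → coeffOf _≟ʷ_ cs w ≈ 0#
    monomials-independent cs rel w = monomials-independent-unique char0 (coeffOf _≟ʷ_ cs)
      (index-unique _≟ʷ_ w cs) (λ z → trans (sym (combine-collect _≟ʷ_ (monomial z) w cs)) (rel z))
      (∈-index _≟ʷ_ w cs)

    module _ {r} (L : ∀ μ → IrreducibleSp r μ) where

      private
        module H μ = HasHighestWeight (IrreducibleSp.highestWeight (L μ))

      weightMultiplicity : Weight r → PartitionAtMost r → Carrier
      weightMultiplicity w μ = sum (λ k → indicator (H.weights μ k ≟ʷ w))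

      weightMultiplicity-highest : ∀ μ → weightMultiplicity (partitionWeight μ) μ # 0#
      weightMultiplicity-highest μ with sum-indicator-positive
          (λ k → H.weights μ k ≟ʷ partitionWeight μ) (H.attained μ)
      ... | j , eq = #-congˡ (sym eq) (char0 j)
        where
        #-congˡ : ∀ {x y} → x ≈ y → x # 0# → y # 0#
        #-congˡ {x} {y} x≈y x#0 with #-cotrans x#0 y
        ... | inj₁ x#y = contradiction x#y (#-irrefl x≈y)
        ... | inj₂ y#0 = y#0

      -- A weight of `L μ` is either the highest one or strictly lower in height. This makes the
      -- matrix of weight multiplicities triangular.
      weightMultiplicity-vanish : ∀ {κ μ} → κ ≢ μ → ¬ height (partitionWeight κ)
          ℤ.< height (partitionWeight μ) →
        weightMultiplicity (partitionWeight κ) μ ≈ 0#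
      weightMultiplicity-vanish {κ} {μ} κ≢μ κ≮μ = sum-zero (λ k →
        indicator-false (H.weights μ k ≟ʷ partitionWeight κ) (λ eq →
          [ (λ μ≡ → κ≢μ (≡.sym (partitionWeight-injective (≡.trans μ≡ eq))))
          , (λ lt → κ≮μ (≡.subst (λ w → height w ℤ.< height (partitionWeight μ)) eq lt)) ]
          (height-dominated (H.highest μ k))))

      weightExpansion : List (Carrier × PartitionAtMost r) → List (Carrier × Weight r)
      weightExpansion = concatMap (λ (x , μ) → tabulate (λ k → x , H.weights μ k))

      combine-weightExpansion : ∀ g cs →
        combine g (weightExpansion cs) ≈ combine (λ μ → sum (λ k → g (H.weights μ k))) cs
      combine-weightExpansion g cs = trans
        (sumList-concatMap (λ (x , w) → x * g w) (λ (x , μ) → tabulate (λ k → x , H.weights μ k)) cs)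
        (sumList-cong (λ (x , μ) → trans (sumList-tabulate (λ (x , w) → x * g w)
            (λ k → x , H.weights μ k))
          (sym (*-sum x (λ k → g (H.weights μ k))))) cs)

      -- By descending induction on the height: the coefficient of z^κ in sp_μ is a positive integer
      -- for μ = κ, and vanishes unless μ = κ or μ is higher than κ.
      sp-independent : ∀ (cs : List (Carrier × PartitionAtMost r)) →
        (∀ z → combine (λ μ → sp L μ z) cs ≈ 0#) → ∀ μ → coeffOf _≟ᴾ_ cs μ ≈ 0#
      sp-independent cs rel μ₀ = descend ℤ.∣ top ℤ.- h μ₀ ∣ (∈-index _≟ᴾ_ μ₀ cs) enough
        where
        T = index _≟ᴾ_ μ₀ cs
        a = coeffOf _≟ᴾ_ cs
        h : PartitionAtMost r → ℤ
        h = height ∘ partitionWeight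
        top = proj₁ (upperBound h T)

        enough : top ℤ.≤ h μ₀ ℤ.+ + ℤ.∣ top ℤ.- h μ₀ ∣
        enough = ≡.subst (ℤ._≤ h μ₀ ℤ.+ + ℤ.∣ top ℤ.- h μ₀ ∣) (lemma top (h μ₀))
            (ℤ.+-monoʳ-≤ (h μ₀) (i≤∣i∣ (top ℤ.- h μ₀)))
          where
          lemma : ∀ i j → j ℤ.+ (i ℤ.- j) ≡ i
          lemma = ℤSolver.solve-∀

        -- The coefficient of one monomial after every character is expanded into its weights.
        weightRelation : ∀ w → sumList (λ μ → a μ * weightMultiplicity w μ) T ≈ 0#
        weightRelation w = begin
          sumList (λ μ → a μ * weightMultiplicity w μ) T
            ≈⟨ combine-collect _≟ᴾ_ (weightMultiplicity w) μ₀ cs ⟨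
          combine (weightMultiplicity w) cs
            ≈⟨ combine-weightExpansion (λ v → indicator (v ≟ʷ w)) cs ⟨
          coeffOf _≟ʷ_ (weightExpansion cs) w
            ≈⟨ monomials-independent (weightExpansion cs)
                (λ z → trans (combine-weightExpansion (monomial z) cs)
                 (trans (sumList-cong (λ (x , μ) → *-congˡ
                     (sym (character-weights (IrreducibleSp.highestWeight (L μ)) z))) cs)
                   (rel z))) w ⟩
          0# ∎

        -- `n` bounds the distance from `h κ` up to `top`. Since `top` strictly exceeds all heights
        -- in `T`, the case `zero` is impossible.
        descend : ∀ n {κ} → κ ∈ T → top ℤ.≤ h κ ℤ.+ + n → a κ ≈ 0#
        descend zero {κ} κ∈ bd = contradiction
          (≡.subst (top ℤ.≤_) (ℤ.+-identityʳ (h κ)) bd) (ℤ.<⇒≱ (proj₂ (upperBound h T) κ∈))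
        descend (suc n) {κ} κ∈ bd = #0⇒*-cancel (weightMultiplicity-highest κ) (begin
          a κ * weightMultiplicity (partitionWeight κ) κ
            ≈⟨ sumList-indicator _≟ᴾ_ f (index-unique _≟ᴾ_ μ₀ cs) κ∈ ⟨
          sumList (λ μ → indicator (κ ≟ᴾ μ) * f μ) T
            ≈⟨ sumList-cong-∈ T (λ {μ} μ∈ → pick μ∈ (κ ≟ᴾ μ) (h κ ℤ.<? h μ)) ⟩
          sumList f T
            ≈⟨ weightRelation (partitionWeight κ) ⟩
          0# ∎)
          where
          f : PartitionAtMost r → Carrier
          f μ = a μ * weightMultiplicity (partitionWeight κ) μ

          higher : ∀ {μ} → h κ ℤ.< h μ → top ℤ.≤ h μ ℤ.+ + n
          higher {μ} lt = ℤ.≤-trans bd (≡.subst (ℤ._≤ h μ ℤ.+ + n) (lemma (h κ) (+ n))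
            (ℤ.+-monoˡ-≤ (+ n) (ℤ.i<j⇒suc[i]≤j lt)))
            where
            lemma : ∀ i j → (+ 1 ℤ.+ i) ℤ.+ j ≡ i ℤ.+ (+ 1 ℤ.+ j)
            lemma = ℤSolver.solve-∀

          -- Apart from `κ` itself, a higher `μ` drops out through its coefficient, by induction,
          -- and any other through its weight multiplicity.
          pick : ∀ {μ} → μ ∈ T → (d : Dec (κ ≡ μ)) → Dec (h κ ℤ.< h μ) → indicator d * f μ ≈ f μ
          pick μ∈ (yes _)  _          = *-identityˡ _
          pick {μ} μ∈ (no κ≢μ) (yes κ<μ)  = trans (zeroˡ _)
            (sym (trans (*-congʳ (descend n μ∈ (higher {μ} κ<μ))) (zeroˡ _)))
          pick {μ} μ∈ (no κ≢μ) (no κ≮μ)   = trans (zeroˡ _)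
            (sym (trans (*-congˡ (weightMultiplicity-vanish κ≢μ κ≮μ)) (zeroʳ _)))

-- Comparison of the two expansions

infix 4 _≟²_

_≟²_ : ∀ {m r} → DecidableEquality (PartitionAtMost m × PartitionAtMost r)
_≟²_ = Product.≡-dec _≟ᴾ_ _≟ᴾ_

module Comparison {c ℓ₁ ℓ₂} (F : HeytingField c ℓ₁ ℓ₂) where
  open HeytingField F hiding (zero)
  open Characters F
  open CommutativeRing commutativeRing using (ring; semiring)
  open RingProperties ring using (-‿distribˡ-*; -0#≈0#; x∙y⁻¹≈ε⇒x≈y; -‿+-comm)
  open SemiringMult semiring using (×-assoc-*; ×-comm-*; ×-congʳ)
  open Sums F
  open SchurFunctions F
  open Traces F
  open RootsOfUnity F
  open Combinations F
  open import Relation.Binary.Reasoning.Setoid setoid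

  ·ℤ-assoc-* : ∀ n x y → n ·ℤ (x * y) ≈ (n ·ℤ x) * y
  ·ℤ-assoc-* (+ n)    x y = sym (×-assoc-* n x y)
  ·ℤ-assoc-* -[1+ n ] x y = trans (-‿cong (sym (×-assoc-* (suc n) x y))) (-‿distribˡ-* _ _)

  ·ℕ-zero : ∀ n → n ·ℕ 0# ≈ 0#
  ·ℕ-zero zero    = refl
  ·ℕ-zero (suc n) = trans (+-identityˡ _) (·ℕ-zero n)

  sumList-neg : ∀ {a} {A : Set a} (f : A → Carrier) xs → sumList (λ i → - f i) xs ≈ - sumList f xs
  sumList-neg f []       = sym -0#≈0#
  sumList-neg f (x ∷ xs) = trans (+-congˡ (sumList-neg f xs)) (-‿+-comm _ _)

  sum-indicator-count : ∀ {n a p} {A : Set a} {P : A → Set p} (P? : ∀ x → Dec (P x)) (xs : Vec A n) →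
    sum (λ k → indicator (P? (Vec.lookup xs k))) ≈ Vec.count P? xs ·ℕ 1#
  sum-indicator-count P? []       = refl
  sum-indicator-count P? (x ∷ xs) with P? x
  ... | yes _ = +-congˡ (sum-indicator-count P? xs)
  ... | no _  = trans (+-identityˡ _) (sum-indicator-count P? xs)

  -- Each pair in `S` is met by exactly one `η` in the list of first components, and a pair with
  -- second component `μ` outside `S` contributes 0.
  sumList-section : ∀ {m r} (g : PartitionAtMost m → PartitionAtMost r → Carrier) {S} → Unique S →
    (∀ η μ → (η , μ) ∉ S → g η μ ≈ 0#) → ∀ μ →
    sumList (λ η → g η μ) (deduplicate _≟ᴾ_ (map proj₁ S)) ≈
    sumList (λ (η , κ) → g η κ * indicator (κ ≟ᴾ μ)) S
  sumList-section {m} {r} g {S} u vanish μ = begin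
    sumList (λ η → g η μ) T
      ≈⟨ sumList-cong (λ η → expand η ((η , μ) ∈? S)) T ⟩
    sumList (λ η → sumList (λ (η′ , κ) → indicator ((η , μ) ≟² (η′ , κ)) * g η′ κ) S) T
      ≈⟨ sumList-comm (λ η (η′ , κ) → indicator ((η , μ) ≟² (η′ , κ)) * g η′ κ) T S ⟩
    sumList (λ (η′ , κ) → sumList (λ η → indicator ((η , μ) ≟² (η′ , κ)) * g η′ κ) T) S
      ≈⟨ sumList-cong-∈ S (λ {(η′ , κ)} ∈S → trans
           (sumList-cong (λ η → trans
             (*-congʳ (indicator-× ((η , μ) ≟² (η′ , κ)) (η′ ≟ᴾ η) (κ ≟ᴾ μ)
                 (λ { ≡.refl → ≡.refl , ≡.refl }) (λ { ≡.refl ≡.refl → ≡.refl })))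
             (trans (*-assoc _ _ _) (*-congˡ (*-comm _ _)))) T)
           (sumList-indicator _≟ᴾ_ (λ _ → g η′ κ * indicator (κ ≟ᴾ μ)) (Unique.deduplicate-! _≟ᴾ_ _)
             (∈-deduplicate⁺ _≟ᴾ_ (∈-map⁺ proj₁ ∈S)))) ⟩
    sumList (λ (η , κ) → g η κ * indicator (κ ≟ᴾ μ)) S ∎
    where
    open DecMembership (_≟²_ {m} {r}) using (_∈?_)
    T = deduplicate _≟ᴾ_ (map proj₁ S)
    expand : ∀ η → Dec ((η , μ) ∈ S) →
      g η μ ≈ sumList (λ (η′ , κ) → indicator ((η , μ) ≟² (η′ , κ)) * g η′ κ) S
    expand η (yes ∈S) = sym (sumList-indicator _≟²_ (λ (η′ , κ) → g η′ κ) u ∈S)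
    expand η (no ∉S)  = trans (vanish η μ ∉S) (sym (sumList-indicator-∉ _≟²_ (λ (η′ , κ) → g η′ κ) ∉S))

  module _ (char0 : CharacteristicZero) {t m r} (t≡ : t ≡ suc m ℕ.+ suc m) (ζ : PrimitiveRoot t)
    (V : ∀ ν → IrreducibleGL (r ℕ.+ r) ν)
    (L : ∀ μ → IrreducibleSp r μ)
    (M : ∀ η → IrreducibleSp m η)
    (D : ∀ ν → Decomposition L (restrict (polynomialModule (V ν))))
    (lam : Partition)
    (E : SymplecticExpansion M L (schurAt±1,y,z (parts lam))) where

    private
      module E = SymplecticExpansion E
      p = parts lam
      isP = parts-isPartition lam

      T : List (PartitionAtMost (r ℕ.+ r))
      T = partitionsIn (r ℕ.+ r) (head₀ p)

      b : PartitionAtMost (r ℕ.+ r) → PartitionAtMost r → ℕ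
      b ν = multiplicity (D ν)

      ε′ : PartitionAtMost (r ℕ.+ r) → Carrier
      ε′ ν = ε ζ p (partsOf ν)

      y : Fin m → Unit
      y i = ξ ζ ^ᵘ suc (toℕ i)

      g : PartitionAtMost m → PartitionAtMost r → Carrier
      g η μ = E.B η μ ·ℤ τᶜ ζ M η

      constituent : ∀ ν → Fin (Decomposition.count (D ν)) → PartitionAtMost r
      constituent ν = Vec.lookup (Decomposition.constituents (D ν))

      -- The two expansions, the second one negated. A constituent is listed as often as it occurs,
      -- so collecting coefficients produces `b`.
      left right : List (Carrier × PartitionAtMost r)
      left  = concatMap (λ ν → tabulate (λ k → ε′ ν , constituent ν k)) T
      right = map (λ (η , μ) → - g η μ , μ) E.support

      combine-left : ∀ f → combine f left ≈ sumList (λ ν → ε′ ν * sum (λ k → f (constituent ν k))) T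
      combine-left f = trans
        (sumList-concatMap (λ (x , i) → x * f i) (λ ν → tabulate (λ k → ε′ ν , constituent ν k)) T)
        (sumList-cong (λ ν → trans (sumList-tabulate (λ (x , i) → x * f i)
            (λ k → ε′ ν , constituent ν k))
          (sym (*-sum (ε′ ν) (f ∘ constituent ν)))) T)

      combine-right : ∀ f → combine f right ≈ - sumList (λ (η , μ) → g η μ * f μ) E.support
      combine-right f = trans (sumList-map (λ (x , i) → x * f i) _ E.support)
        (trans (sumList-cong (λ (η , μ) → sym (-‿distribˡ-* (g η μ) (f μ))) E.support)
          (sumList-neg (λ (η , μ) → g η μ * f μ) E.support))

      -- `t` and `ζ` are quantified anew because the `t` of the enclosing module is fixed and its
      -- equation cannot be matched with `≡.refl`.
      schur-unity : ∀ {t} → t ≡ suc m ℕ.+ suc m → (ζ : PrimitiveRoot t) → ∀ ws →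
        schur p (1# ∷ - 1# ∷ tabulate (val ∘ z,z⁻¹ {m} (λ i → ξ ζ ^ᵘ suc (toℕ i))) ++ ws) ≈
        schur p (rootsOfUnity ζ ++ ws)
      schur-unity ≡.refl ζ ws = schur-rootsOfUnity ζ isP ws

      relation : ∀ z → combine (λ μ → sp L μ z) (left ++ right) ≈ 0#
      relation z = begin
        combine (λ μ → sp L μ z) (left ++ right)
          ≈⟨ sumList-++ (λ (x , μ) → x * sp L μ z) left right ⟩
        combine (λ μ → sp L μ z) left + combine (λ μ → sp L μ z) right
          ≈⟨ +-cong (combine-left (λ μ → sp L μ z)) (combine-right (λ μ → sp L μ z)) ⟩
        sumList (λ ν → ε′ ν * sum (λ k → sp L (constituent ν k) z)) T
          + - sumList (λ (η , μ) → g η μ * sp L μ z) E.support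
          ≈⟨ +-congʳ (sumList-cong (λ ν → *-congˡ (schur-restriction (V ν) (D ν) z)) T) ⟨
        sumList (λ ν → ε′ ν * schur (partsOf ν) zs) T
          + - sumList (λ (η , μ) → g η μ * sp L μ z) E.support
          ≈⟨ +-cong (schur-branching (r ℕ.+ r) (rootsOfUnity ζ) zs isP ℕ.≤-refl
              (ℕ.≤-reflexive (List.length-tabulate _)))
               (-‿cong (sumList-cong (λ (η , μ) → ·ℤ-assoc-* (E.B η μ) (τᶜ ζ M η) (sp L μ z))
                   E.support)) ⟨
        schur p (rootsOfUnity ζ ++ zs)
          + - sumList (λ (η , μ) → E.B η μ ·ℤ (sp M η y * sp L μ z)) E.support
          -- The expansion is used at the powers ξ, ..., ξᵐ, where `sp M η y` is `τᶜ ζ M η` by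
          -- definition.
          ≈⟨ +-cong (schur-unity t≡ ζ zs) (-‿cong (E.expansion y z)) ⟨
        schurAt±1,y,z p y z + - schurAt±1,y,z p y z
          ≈⟨ -‿inverseʳ _ ⟩
        0# ∎
        where
        zs = tabulate (val ∘ z,z⁻¹ z)

      -- The coefficient at `μ` of the vanishing combination: on the left it counts the constituents
      -- equal to `μ`.
      balance : ∀ μ → sumList (λ ν → b ν μ ·ℕ ε′ ν) T ≈
                      sumList (λ (η , κ) → g η κ * indicator (κ ≟ᴾ μ)) E.support
      balance μ = x∙y⁻¹≈ε⇒x≈y _ _ (begin
        sumList (λ ν → b ν μ ·ℕ ε′ ν) T + - sumList (λ (η , κ) → g η κ * indicator (κ ≟ᴾ μ)) E.support
          ≈⟨ +-congʳ (sumList-cong (λ ν → trans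
               (*-congˡ (sum-indicator-count (_≟ᴾ μ) (Decomposition.constituents (D ν))))
               (trans (×-comm-* (b ν μ) (ε′ ν) 1#) (×-congʳ (b ν μ) (*-identityʳ _)))) T) ⟨
        sumList (λ ν → ε′ ν * sum (λ k → indicator (constituent ν k ≟ᴾ μ))) T
          + - sumList (λ (η , κ) → g η κ * indicator (κ ≟ᴾ μ)) E.support
          ≈⟨ +-cong (combine-left (λ κ → indicator (κ ≟ᴾ μ)))
              (combine-right (λ κ → indicator (κ ≟ᴾ μ))) ⟨
        combine (λ κ → indicator (κ ≟ᴾ μ)) left + combine (λ κ → indicator (κ ≟ᴾ μ)) right
          ≈⟨ sumList-++ (λ (x , κ) → x * indicator (κ ≟ᴾ μ)) left right ⟨
        coeffOf _≟ᴾ_ (left ++ right) μ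
          ≈⟨ sp-independent char0 L (left ++ right) relation μ ⟩
        0# ∎)

    comparison : ∀ μ → ∃[ s ] HasSum (λ ν → multiplicity (D ν) μ ·ℕ ε ζ p (partsOf ν)) s
                            × HasSum (λ η → B E η μ ·ℤ τᶜ ζ M η) s
    comparison μ = sumList (λ ν → b ν μ ·ℕ ε′ ν) T
      , record
          { support  = T
          ; distinct = partitionsIn-unique (r ℕ.+ r) (head₀ p)
          -- A `ν` outside the rectangle has a first row longer than that of λ.
          ; vanish   = λ ν ν∉ → trans
              (×-congʳ (b ν μ) (skewSchur-vanish (rootsOfUnity ζ) isP ℕ.≤-refl
                  (λ h → ν∉ (∈-partitionsIn ν h))))
              (·ℕ-zero (b ν μ))
          ; total    = refl
          }
      , record
          { support  = deduplicate _≟ᴾ_ (map proj₁ E.support)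
          ; distinct = Unique.deduplicate-! _≟ᴾ_ (map proj₁ E.support)
          ; vanish   = λ η η∉ → g-vanish η μ (λ ∈S → η∉ (∈-deduplicate⁺ _≟ᴾ_ (∈-map⁺ proj₁ ∈S)))
          ; total    = trans (balance μ) (sym (sumList-section g E.distinct g-vanish μ))
          }
      where
      g-vanish : ∀ η μ → (η , μ) ∉ E.support → g η μ ≈ 0#
      g-vanish η μ ∉S = reflexive (≡.cong (_·ℤ τᶜ ζ M η) (E.vanish η μ ∉S))

open import Data.Nat using (_+_; _*_)

proposition11p1 :
    ∀ {c ℓ₁ ℓ₂} (F : HeytingField c ℓ₁ ℓ₂) →
    let module K = HeytingField F
        open Characters F
    in CharacteristicZero →
    (t m r : ℕ) → t ≡ 2 * m + 2 → 4 ≤ t → 1 ≤ r →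
    (ζ : PrimitiveRoot t) →
    (V : ∀ ν → IrreducibleGL (r + r) ν)
    (L : ∀ μ → IrreducibleSp r μ)
    (M : ∀ η → IrreducibleSp m η) →
    (D : ∀ ν → Decomposition L (restrict (polynomialModule (V ν)))) →
    (lam : Partition) → length (parts lam) < t + 2 * r →
    (E : SymplecticExpansion M L (schurAt±1,y,z (parts lam))) →
    (μ : PartitionAtMost r) →
    ∃[ s ] HasSum (λ ν → multiplicity (D ν) μ ·ℕ ε ζ (parts lam) (partsOf ν)) s
         × HasSum (λ η → B E η μ ·ℤ τᶜ ζ M η) s
proposition11p1 F char0 t m r t≡ _ _ ζ V L M D lam _ E μ =
  Comparison.comparison F char0 (≡.trans t≡ (double m)) ζ V L M D lam E μ
  where
  double : ∀ m → 2 * m + 2 ≡ suc m + suc m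
  double = ℕSolver.solve-∀
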